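{- The permutations $25134$ and $23514$ form an annihilator pair: for every permutation $\tau$ and every pair of distinct indices $i,j\le|\tau|$, the permutation $\tau_{i,j}[25134,23514]$ satisfies $\mu[1,\tau_{i,j}[25134,23514]]=0$.
   Context: Permutations are ordered by containment: $\sigma\le\pi$ if $\pi$ has a subsequence order-isomorphic to $\sigma$. The Möbius function: $\mu[\sigma,\pi]=0$ if $\sigma\not\le\pi$, $\mu[\sigma,\pi]=1$ if $\sigma=\pi$, and $\mu[\sigma,\pi]=-\sum_{\sigma\le\tau<\pi}\mu[\sigma,\tau]$ otherwise; $1$ is the permutation of length one. For a permutation $\tau$ of length $m$, distinct indices $i,j\le m$ and non-empty permutations $\phi,\psi$, the inflation $\tau_{i,j}[\phi,\psi]$ is the permutation obtained from $\tau$ by replacing the entry $\tau_i$ by a block of $|\phi|$ consecutive positions whose values form a set of consecutive integers and are order-isomorphic to $\phi$, replacing $\tau_j$ likewise by a block order-isomorphic to $\psi$, and keeping every other entry as a single entry, so that the relative order between different blocks/entries is that of the corresponding entries of $\tau$. -}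

module Defs where

open import Data.Nat using (ℕ; zero; suc; _+_; _<_; _<ᵇ_; _≟_)
open import Data.Bool using (Bool; true; false; if_then_else_)
open import Data.Integer using (ℤ) renaming (_+_ to _+ℤ_; -_ to -ℤ_)
import Data.Integer as ℤ
open import Data.List using (List; []; _∷_; map; length; sum; upTo; zip; concatMap; filter)
import Data.List.Properties as LP
open import Data.List.Relation.Binary.Permutation.Propositional using (_↭_)
open import Data.Product using (_×_; _,_)
open import Relation.Nullary using (Dec; yes; no)
open import Relation.Nullary.Decidable using (⌊_⌋)
open import Relation.Binary.PropositionalEquality using (_≡_)

-- Permutations of length n are lists of the values 0 … n-1 (0-based one-line notation).
Perm : Set
Perm = List ℕ

IsPerm : Perm → Set
IsPerm p = p ↭ upTo (length p)

_≟L_ : (xs ys : List ℕ) → Dec (xs ≡ ys)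
_≟L_ = LP.≡-dec _≟_

countLess : ℕ → List ℕ → ℕ
countLess x [] = 0
countLess x (y ∷ ys) = (if y <ᵇ x then 1 else 0) + countLess x ys

st : List ℕ → List ℕ
st xs = map (λ x → countLess x xs) xs

subs : List ℕ → List (List ℕ)
subs [] = [] ∷ []
subs (x ∷ xs) = map (x ∷_) (subs xs) Data.List.++ subs xs

elem : List ℕ → List (List ℕ) → Bool
elem x [] = false
elem x (y ∷ ys) = if ⌊ x ≟L y ⌋ then true else elem x ys

patterns : List ℕ → List (List ℕ)
patterns π = map st (subs π)

contains : List ℕ → List ℕ → Bool
contains σ π = elem σ (patterns π)

_≼_ : Perm → Perm → Set
σ ≼ π = contains σ π ≡ true

dedup : List (List ℕ) → List (List ℕ)
dedup [] = []
dedup (x ∷ xs) = if elem x xs then dedup xs else x ∷ dedup xs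

properPatterns : List ℕ → List (List ℕ)
properPatterns π = filter (λ τ → Relation.Nullary.¬? (τ ≟L π)) (dedup (patterns π))

sumℤ : List ℤ → ℤ
sumℤ [] = ℤ.0ℤ
sumℤ (x ∷ xs) = x +ℤ sumℤ xs

-- Möbius function of the permutation poset, by recursion with fuel
-- (τ ranging over the proper patterns of π has |τ| < |π|).
muF : ℕ → Perm → Perm → ℤ
muF zero σ π = ℤ.0ℤ
muF (suc k) σ π with σ ≟L π
... | yes _ = ℤ.1ℤ
... | no _ = if contains σ π
             then -ℤ sumℤ (map (muF k σ) (filter (λ τ → Data.Bool._≟_ (contains σ τ) true) (properPatterns π)))
             else ℤ.0ℤ

μ : Perm → Perm → ℤ
μ σ π = muF (suc (length π)) σ π

offset : ℕ → List (ℕ × List ℕ) → ℕ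
offset t [] = 0
offset t ((t' , b) ∷ rest) = (if t' <ᵇ t then length b else 0) + offset t rest

inflateAll : List (ℕ × List ℕ) → List ℕ
inflateAll tbs = concatMap (λ { (t , b) → map (offset t tbs +_) b }) tbs

-- τ_{i,j}[φ,ψ]  (positions i, j are 0-based)
blockAt : ℕ → ℕ → Perm → Perm → ℕ → List ℕ
blockAt i j φ ψ k = if ⌊ k ≟ i ⌋ then φ else if ⌊ k ≟ j ⌋ then ψ else (0 ∷ [])

inflate2 : Perm → ℕ → ℕ → Perm → Perm → Perm
inflate2 τ i j φ ψ = inflateAll (zip τ (map (blockAt i j φ ψ) (upTo (length τ))))

p25134 : Perm
p25134 = 1 ∷ 4 ∷ 0 ∷ 2 ∷ 3 ∷ []

p23514 : Perm
p23514 = 1 ∷ 2 ∷ 4 ∷ 0 ∷ 3 ∷ []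

{-# OPTIONS --safe #-}
-- For |ρ| ≥ 2 the values μ[1,τ] over all τ ≤ ρ sum to 0. Hence μ[1,π] = 0 as soon as some integer combination f of
-- indicators of ideals {τ ≤ ρ} with 2 ≤ |ρ| and ρ ≤ π satisfies f(π) = 1 and f(τ) = 0 for all τ < π with μ[1,τ] ≠ 0.
--
-- If π has disjoint intervals of shapes z₁ and z₂, let f be the combination with signs +, -, -, + of the ideals of
-- π[z₁,z₂] = π, π[k₁,z₂], π[z₁,k₂] and π[k₁,k₂], where kᵢ < zᵢ. A pattern τ of π with f(τ) ≠ 0 has intervals e₁ and e₂
-- such that eᵢ ≤ zᵢ and eᵢ ≰ kᵢ. So (z₁,z₂) is an annihilator pair if all the other pairs (e₁,e₂) are, where eᵢ may be
-- replaced by any interval of itself, and may be ignored if it is an annihilator. With the annihilators 123, 1243 and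
-- 2134 this gives successively the pairs (12,21), (1423,23514), (25134,231) and (25134,23514), once (1423,231) is known.
-- For the latter, k = (312,12) fails only at patterns without interval 12; subtracting the same combination for
-- z = (132,21) and k = (21,1) repairs this, and changes nothing at patterns without interval 21.
module Submission where

open import Defs
open import Data.Bool using (Bool; true; false; if_then_else_)
import Data.Bool.Properties as Boolₚ
open import Data.Empty using (⊥-elim)
open import Data.Integer using (ℤ; 0ℤ; 1ℤ) renaming (_+_ to _+ᶻ_; _-_ to _-ᶻ_; _*_ to _*ᶻ_; -_ to -ᶻ_)
import Data.Integer.Properties as ℤₚ
open import Algebra.Properties.CommutativeSemigroup ℤₚ.+-commutativeSemigroup using (interchange; x∙yz≈y∙xz)
open import Data.List using (List; []; _∷_; _++_; applyUpTo; concatMap; drop; filter; length; map; take; upTo; zip; zipWith)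
import Data.List.Properties as Listₚ
open import Data.List.Membership.DecPropositional _≟L_ using (_∈?_)
open import Data.List.Membership.Propositional using (_∈_; _∉_)
import Data.List.Membership.Propositional.Properties as ∈ₚ
open import Data.List.Membership.Propositional.Properties.WithK using (unique∧set⇒bag)
open import Data.List.Relation.Binary.BagAndSetEquality using (∼bag⇒↭)
open import Data.List.Relation.Binary.Permutation.Propositional as Perm using (_↭_; ↭-sym; ↭⇒↭ₛ)
import Data.List.Relation.Binary.Permutation.Setoid.Properties as Permₛ
open import Data.List.Relation.Binary.Sublist.Propositional as Sub using (_⊆_; []; _∷_; _∷ʳ_; ⊆-trans; ⊆-refl)
import Data.List.Relation.Binary.Sublist.Propositional.Properties as Subₚ
open import Data.List.Relation.Unary.All as All using (All; []; _∷_)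
import Data.List.Relation.Unary.All.Properties as Allₚ
open import Data.List.Relation.Unary.AllPairs as AllPairs using (AllPairs; []; _∷_)
import Data.List.Relation.Unary.AllPairs.Properties as AllPairsₚ
open import Data.List.Relation.Unary.Any as Any using (Any; here; there)
import Data.List.Relation.Unary.Any.Properties as Anyₚ
open import Data.List.Relation.Unary.Unique.Propositional using (Unique)
import Data.List.Relation.Unary.Unique.Propositional.Properties as Uniqueₚ
open import Data.Nat using (ℕ; zero; suc; _+_; _∸_; _<_; _≤_; _<ᵇ_; z≤n; s≤s; _≟_; _<?_; _≤?_)
import Data.Nat.Properties as ℕₚ
open import Data.Nat.Solver using (module +-*-Solver)
open import Data.Product using (_×_; _,_; proj₁; proj₂; ∃; ∃₂; swap)
open import Data.Sum as Sum using (_⊎_; inj₁; inj₂; [_,_]′)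
open import Data.Unit using (tt)
open import Function using (_∘_; id; mk⇔)
open import Relation.Binary.Definitions using (tri<; tri≈; tri>)
open import Relation.Binary.PropositionalEquality using (_≡_; _≢_; refl; sym; trans; cong; cong₂; subst; subst₂;
  setoid; module ≡-Reasoning)
open import Relation.Nullary using (¬_; Dec; yes; no; ¬?; does; _×-dec_; _⊎-dec_)
open import Relation.Nullary.Decidable using (True; toWitness)
open import Relation.Unary using (Decidable)

private variable
  m n : ℕ
  b c k k₁ k₂ s t u v w x x′ xs y y′ ys z z₁ z₂ zs π ρ : List ℕ
  D E E₁ E₂ : List (List ℕ)

-- Order isomorphism, containment and intervals

infix 4 _≃_ _≅_ _≲_

-- Both directions are compared because arbitrary lists may repeat entries; booleans keep the
-- relation decidable by evaluation.
SameOrder : ℕ → ℕ → ℕ → ℕ → Set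
SameOrder a b c d = (a <ᵇ b) ≡ (c <ᵇ d) × (b <ᵇ a) ≡ (d <ᵇ c)

_≃_ : ℕ × ℕ → ℕ × ℕ → Set
(a , c) ≃ (b , d) = SameOrder a b c d

-- Keeping the zipped pairs, with both lists as projections, turns restriction to a subsequence of
-- one side into the choice of a sublist of `pairs`.
record _≅_ (xs ys : List ℕ) : Set where
  constructor zipped
  field
    pairs  : List (ℕ × ℕ)
    left   : map proj₁ pairs ≡ xs
    right  : map proj₂ pairs ≡ ys
    orders : AllPairs _≃_ pairs

n≮ᵇn : ∀ n → (n <ᵇ n) ≡ false
n≮ᵇn zero    = refl
n≮ᵇn (suc n) = n≮ᵇn n

<ᵇ-true : m < n → (m <ᵇ n) ≡ true
<ᵇ-true {x} {y} p with x <ᵇ y | ℕₚ.<⇒<ᵇ p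
... | true | _ = refl

<ᵇ-false : n ≤ m → (m <ᵇ n) ≡ false
<ᵇ-false {y} {x} p with x <ᵇ y | ℕₚ.<ᵇ⇒< x y
... | false | _ = refl
... | true  | f = ⊥-elim (ℕₚ.<⇒≱ (f tt) p)

allPairs-∈ : {A : Set} {R : A → A → Set} {as : List A} → (∀ {a} → R a a) → (∀ {a b} → R a b → R b a) →
             AllPairs R as → ∀ {a b} → a ∈ as → b ∈ as → R a b
allPairs-∈ r s (_ ∷ _)  (here refl) (here refl) = r
allPairs-∈ r s (h ∷ _)  (here refl) (there q)   = All.lookup h q
allPairs-∈ r s (h ∷ _)  (there p)   (here refl) = s (All.lookup h p)
allPairs-∈ r s (_ ∷ hs) (there p)   (there q)   = allPairs-∈ r s hs p q

∈⇒allPairs : {A : Set} {R : A → A → Set} {as : List A} → (∀ {a b} → a ∈ as → b ∈ as → R a b) → AllPairs R as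
∈⇒allPairs {as = []}     h = []
∈⇒allPairs {as = a ∷ as} h = All.tabulate (h (here refl) ∘ there) ∷ ∈⇒allPairs (λ p q → h (there p) (there q))

orders-∈ : ∀ {ps} → AllPairs _≃_ ps → ∀ {p q} → p ∈ ps → q ∈ ps → p ≃ q
orders-∈ = allPairs-∈ (λ {(a , c)} → trans (n≮ᵇn a) (sym (n≮ᵇn c)) , trans (n≮ᵇn a) (sym (n≮ᵇn c))) swap

countLess-zip : ∀ a c ps → All (λ p → (proj₁ p <ᵇ a) ≡ (proj₂ p <ᵇ c)) ps →
                countLess a (map proj₁ ps) ≡ countLess c (map proj₂ ps)
countLess-zip a c []       []       = refl
countLess-zip a c (p ∷ ps) (h ∷ hs) =
  cong₂ _+_ (cong (if_then 1 else 0) h) (countLess-zip a c ps hs)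

≅⇒st≡ : xs ≅ ys → st xs ≡ st ys
≅⇒st≡ (zipped ps refl refl o) = begin
  map (λ x → countLess x (map proj₁ ps)) (map proj₁ ps) ≡⟨ sym (Listₚ.map-∘ ps) ⟩
  map (λ p → countLess (proj₁ p) (map proj₁ ps)) ps     ≡⟨ Listₚ.map-cong-local
    (All.tabulate (λ {p} p∈ → countLess-zip (proj₁ p) (proj₂ p) ps (All.tabulate (λ q∈ → proj₁ (orders-∈ o q∈ p∈))))) ⟩
  map (λ p → countLess (proj₂ p) (map proj₂ ps)) ps     ≡⟨ Listₚ.map-∘ ps ⟩
  map (λ x → countLess x (map proj₂ ps)) (map proj₂ ps) ∎
  where open ≡-Reasoning

bit-mono : m ≤ n → ∀ k → (if k <ᵇ m then 1 else 0) ≤ (if k <ᵇ n then 1 else 0)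
bit-mono {x} {y} x≤y z with z <ᵇ x | ℕₚ.<ᵇ⇒< z x
... | false | _ = z≤n
... | true  | f rewrite <ᵇ-true (ℕₚ.<-≤-trans (f tt) x≤y) = ℕₚ.≤-refl

countLess-mono-≤ : m ≤ n → ∀ xs → countLess m xs ≤ countLess n xs
countLess-mono-≤ x≤y []       = z≤n
countLess-mono-≤ x≤y (z ∷ zs) = ℕₚ.+-mono-≤ (bit-mono x≤y z) (countLess-mono-≤ x≤y zs)

-- The entry `m` itself is counted below `n` but not below `m`, which makes the inequality strict.
countLess-mono-< : m < n → m ∈ xs → countLess m xs < countLess n xs
countLess-mono-< {x} {xs = _ ∷ zs} x<y (here refl) rewrite n≮ᵇn x | <ᵇ-true x<y = s≤s (countLess-mono-≤ (ℕₚ.<⇒≤ x<y) zs)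
countLess-mono-< {xs = z ∷ _} x<y (there p) = ℕₚ.+-mono-≤-< (bit-mono (ℕₚ.<⇒≤ x<y) z) (countLess-mono-< x<y p)

countLess-order : m ∈ xs → (m <ᵇ n) ≡ (countLess m xs <ᵇ countLess n xs)
countLess-order {x} {zs} {y} x∈ with ℕₚ.<-≤-connex x y
... | inj₁ x<y = trans (<ᵇ-true x<y) (sym (<ᵇ-true (countLess-mono-< x<y x∈)))
... | inj₂ y≤x = trans (<ᵇ-false y≤x) (sym (<ᵇ-false (countLess-mono-≤ y≤x zs)))

≅-st : ∀ xs → xs ≅ st xs
≅-st xs = zipped (map (λ x → x , countLess x xs) xs)
  (trans (sym (Listₚ.map-∘ xs)) (Listₚ.map-id xs)) (sym (Listₚ.map-∘ xs))
  (AllPairsₚ.map⁺ (∈⇒allPairs (λ p q → countLess-order p , countLess-order q)))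

≅-sym : xs ≅ ys → ys ≅ xs
≅-sym (zipped ps refl refl o) = zipped (map swap ps) (sym (Listₚ.map-∘ ps)) (sym (Listₚ.map-∘ ps))
  (AllPairsₚ.map⁺ (AllPairs.map (λ (p , q) → sym p , sym q) o))

map-⊆⁻¹ : {A B : Set} (f : A → B) (as : List A) {bs : List B} → bs ⊆ map f as →
          ∃ λ as′ → as′ ⊆ as × bs ≡ map f as′
map-⊆⁻¹ f []       []         = [] , [] , refl
map-⊆⁻¹ f (a ∷ as) (_ ∷ʳ p)   = let as′ , q , e = map-⊆⁻¹ f as p in as′ , a ∷ʳ q , e
map-⊆⁻¹ f (a ∷ as) (refl ∷ p) = let as′ , q , e = map-⊆⁻¹ f as p in a ∷ as′ , refl ∷ q , cong (f a ∷_) e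

allPairs-⊆ : {A : Set} {R : A → A → Set} {as bs : List A} → as ⊆ bs → AllPairs R bs → AllPairs R as
allPairs-⊆ []         []       = []
allPairs-⊆ (_ ∷ʳ p)   (_ ∷ hs) = allPairs-⊆ p hs
allPairs-⊆ (refl ∷ p) (h ∷ hs) = Subₚ.All-resp-⊆ p h ∷ allPairs-⊆ p hs

≅-⊆ : xs ≅ ys → s ⊆ xs → ∃ λ t → t ⊆ ys × s ≅ t
≅-⊆ (zipped ps refl refl o) p with map-⊆⁻¹ proj₁ ps p
... | qs , q , refl = map proj₂ qs , Subₚ.map⁺ proj₂ q , zipped qs refl refl (allPairs-⊆ q o)

≅-trans : xs ≅ ys → ys ≅ zs → xs ≅ zs
≅-trans (zipped ps refl r o) (zipped qs l refl o′) =
  zipped (glue ps qs) (left-glue ps qs e) (right-glue ps qs e) (orders-glue ps qs e o o′)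
  where
  e = trans r (sym l)
  glue : List (ℕ × ℕ) → List (ℕ × ℕ) → List (ℕ × ℕ)
  glue = zipWith (λ p q → proj₁ p , proj₂ q)

  left-glue : ∀ ps qs → map proj₂ ps ≡ map proj₁ qs → map proj₁ (glue ps qs) ≡ map proj₁ ps
  left-glue []       []       _ = refl
  left-glue (p ∷ ps) (q ∷ qs) e = cong (_ ∷_) (left-glue ps qs (Listₚ.∷-injectiveʳ e))

  right-glue : ∀ ps qs → map proj₂ ps ≡ map proj₁ qs → map proj₂ (glue ps qs) ≡ map proj₂ qs
  right-glue []       []       _ = refl
  right-glue (p ∷ ps) (q ∷ qs) e = cong (_ ∷_) (right-glue ps qs (Listₚ.∷-injectiveʳ e))

  all-glue : ∀ {a c d} ps qs → map proj₂ ps ≡ map proj₁ qs →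
             All ((a , c) ≃_) ps → All ((c , d) ≃_) qs → All ((a , d) ≃_) (glue ps qs)
  all-glue []       []       _ _ _ = []
  all-glue (p ∷ ps) (q ∷ qs) e ((h₁ , h₂) ∷ hs) ((g₁ , g₂) ∷ gs) with Listₚ.∷-injectiveˡ e
  ... | refl = (trans h₁ g₁ , trans h₂ g₂) ∷ all-glue ps qs (Listₚ.∷-injectiveʳ e) hs gs

  orders-glue : ∀ ps qs → map proj₂ ps ≡ map proj₁ qs →
                AllPairs _≃_ ps → AllPairs _≃_ qs → AllPairs _≃_ (glue ps qs)
  orders-glue []       []       _ _ _ = []
  orders-glue (p ∷ ps) (q ∷ qs) e (h ∷ hs) (g ∷ gs) with Listₚ.∷-injectiveˡ e
  ... | refl = all-glue ps qs (Listₚ.∷-injectiveʳ e) h g ∷ orders-glue ps qs (Listₚ.∷-injectiveʳ e) hs gs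

-- With `≅⇒st≡` this makes `st` a complete invariant, so order isomorphism is decided by comparing
-- lists.
st≡⇒≅ : st xs ≡ st ys → xs ≅ ys
st≡⇒≅ {xs} {ys} e = ≅-trans (≅-st xs) (subst (_≅ ys) (sym e) (≅-sym (≅-st ys)))

≅-refl : xs ≅ xs
≅-refl = st≡⇒≅ refl

≅-length : xs ≅ ys → length xs ≡ length ys
≅-length (zipped ps refl refl _) = trans (Listₚ.length-map proj₁ ps) (sym (Listₚ.length-map proj₂ ps))

st-idem : ∀ xs → st (st xs) ≡ st xs
st-idem xs = sym (≅⇒st≡ (≅-st xs))

length-st : ∀ xs → length (st xs) ≡ length xs
length-st xs = Listₚ.length-map _ xs

SameSide : ℕ → ℕ → ℕ → Set
SameSide e x y = SameOrder e x e y

-- Instead of asking for consecutive values, no outside entry may separate two entries of `b`. This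
-- form passes to sublists and makes sense for lists that are not standardised.
record Interval (u b v : List ℕ) : Set where
  constructor uniform
  field
    side : ∀ {e x y} → e ∈ u ++ v → x ∈ b → y ∈ b → SameSide e x y
open Interval

-- Outside entries are paired with themselves and the block entries by the given isomorphism; the
-- interval condition settles the comparisons between the two kinds.
exchange : Interval u b v → s ⊆ u → t ⊆ v → xs ⊆ b → ys ⊆ b → xs ≅ ys → s ++ xs ++ t ≅ s ++ ys ++ t
exchange {u} {b} {v} {s} {t} I s⊆ t⊆ xs⊆ ys⊆ (zipped ps refl refl o) =
  zipped (map dup s ++ ps ++ map dup t) (unzip proj₁ (λ _ → refl)) (unzip proj₂ (λ _ → refl))
    (AllPairsₚ.++⁺ (diagonal s) (AllPairsₚ.++⁺ o (diagonal t) right-side) left-side)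
  where
  dup : ℕ → ℕ × ℕ
  dup x = x , x
  unzip : (f : ℕ × ℕ → ℕ) → (∀ x → f (dup x) ≡ x) → map f (map dup s ++ ps ++ map dup t) ≡ s ++ map f ps ++ t
  unzip f h = begin
    map f (map dup s ++ ps ++ map dup t)                 ≡⟨ Listₚ.map-++ f (map dup s) _ ⟩
    map f (map dup s) ++ map f (ps ++ map dup t)         ≡⟨ cong₂ _++_ (undup s) (Listₚ.map-++ f ps _) ⟩
    s ++ map f ps ++ map f (map dup t)                   ≡⟨ cong (λ l → s ++ map f ps ++ l) (undup t) ⟩
    s ++ map f ps ++ t                                   ∎
    where
    open ≡-Reasoning
    undup : ∀ l → map f (map dup l) ≡ l
    undup l = trans (sym (Listₚ.map-∘ l)) (trans (Listₚ.map-cong h l) (Listₚ.map-id l))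
  diagonal : ∀ l → AllPairs _≃_ (map dup l)
  diagonal l = AllPairsₚ.map⁺ (∈⇒allPairs (λ _ _ → refl , refl))
  side′ : ∀ {e p} → e ∈ u ++ v → p ∈ ps → dup e ≃ p
  side′ e∈ p∈ = side I e∈ (Sub.lookup xs⊆ (∈ₚ.∈-map⁺ proj₁ p∈)) (Sub.lookup ys⊆ (∈ₚ.∈-map⁺ proj₂ p∈))
  right-side : All (λ p → All (p ≃_) (map dup t)) ps
  right-side = All.tabulate (λ p∈ → Allₚ.map⁺ (All.tabulate (λ e∈ → swap (side′ (∈ₚ.∈-++⁺ʳ u (Sub.lookup t⊆ e∈)) p∈))))
  left-side : All (λ p → All (p ≃_) (ps ++ map dup t)) (map dup s)
  left-side = Allₚ.map⁺ (All.tabulate (λ e∈ → Allₚ.++⁺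
    (All.tabulate (side′ (∈ₚ.∈-++⁺ˡ (Sub.lookup s⊆ e∈)))) (Allₚ.map⁺ (All.tabulate (λ _ → refl , refl)))))

split-⊆ : ∀ (xs : List ℕ) {ys s} → s ⊆ xs ++ ys → ∃₂ λ t u → s ≡ t ++ u × t ⊆ xs × u ⊆ ys
split-⊆ []       p = [] , _ , refl , [] , p
split-⊆ (x ∷ xs) (_ ∷ʳ p) with split-⊆ xs p
... | t , u , e , q , r = t , u , e , x ∷ʳ q , r
split-⊆ (x ∷ xs) (refl ∷ p) with split-⊆ xs p
... | t , u , e , q , r = x ∷ t , u , cong (x ∷_) e , refl ∷ q , r

Interval-⊆ : Interval u b v → s ⊆ u → c ⊆ b → t ⊆ v → Interval s c t
Interval-⊆ I p q r = uniform λ e∈ x∈ y∈ → side I (Sub.lookup (Subₚ.++⁺ p r) e∈) (Sub.lookup q x∈) (Sub.lookup q y∈)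

record Has (z s : List ℕ) : Set where
  constructor has
  field
    {before block after} : List ℕ
    whole    : s ≡ before ++ block ++ after
    shape    : block ≅ z
    interval : Interval before block after

map-split : {A B : Set} (f : A → B) (as : List A) {bs cs : List B} → map f as ≡ bs ++ cs →
            ∃₂ λ as₁ as₂ → as ≡ as₁ ++ as₂ × map f as₁ ≡ bs × map f as₂ ≡ cs
map-split f as       {[]}     e = [] , as , refl , refl , e
map-split f (a ∷ as) {b ∷ bs} e with map-split f as {bs} (Listₚ.∷-injectiveʳ e)
... | as₁ , as₂ , refl , refl , refl = a ∷ as₁ , as₂ , refl , cong (_∷ _) (Listₚ.∷-injectiveˡ e) , refl

-- `pairs` is cut where `s` is cut. A comparison with a block entry in `t` is carried to `s`, moved
-- along the block there, and carried back.
Has-resp-≅ : s ≅ t → Has z s → Has z t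
Has-resp-≅ {z = z} (zipped ps refl refl o) (has {u} {b} e shape I) with map-split proj₁ ps {u} e
... | ps₁ , ps₂₃ , refl , refl , e′ with map-split proj₁ ps₂₃ {b} e′
... | ps₂ , ps₃ , refl , refl , refl = has {before = map proj₂ ps₁} {map proj₂ ps₂} {map proj₂ ps₃}
  (trans (Listₚ.map-++ proj₂ ps₁ _) (cong (map proj₂ ps₁ ++_) (Listₚ.map-++ proj₂ ps₂ ps₃)))
  (≅-trans (≅-sym (zipped ps₂ refl refl (allPairs-⊆ (Subₚ.++⁺ˡ ps₁ (Subₚ.++⁺ʳ ps₃ ⊆-refl)) o))) shape)
  (uniform interval′)
  where
  ⊆-inside : ps₂ ⊆ ps₁ ++ ps₂ ++ ps₃
  ⊆-inside = Subₚ.++⁺ˡ ps₁ (Subₚ.++⁺ʳ ps₃ ⊆-refl)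
  ⊆-outside : ps₁ ++ ps₃ ⊆ ps₁ ++ ps₂ ++ ps₃
  ⊆-outside = Subₚ.++⁺ {as = ps₁} ⊆-refl (Subₚ.++⁺ˡ ps₂ ⊆-refl)
  interval′ : ∀ {e x y} → e ∈ map proj₂ ps₁ ++ map proj₂ ps₃ → x ∈ map proj₂ ps₂ → y ∈ map proj₂ ps₂ → SameSide e x y
  interval′ e∈ x∈ y∈ with ∈ₚ.∈-map⁻ proj₂ (subst (_ ∈_) (sym (Listₚ.map-++ proj₂ ps₁ ps₃)) e∈)
                        | ∈ₚ.∈-map⁻ proj₂ x∈ | ∈ₚ.∈-map⁻ proj₂ y∈
  ... | p , p∈ , refl | q , q∈ , refl | r , r∈ , refl
    with orders-∈ o (Sub.lookup ⊆-outside p∈) (Sub.lookup ⊆-inside q∈)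
       | orders-∈ o (Sub.lookup ⊆-outside p∈) (Sub.lookup ⊆-inside r∈)
       | side I (subst (proj₁ p ∈_) (Listₚ.map-++ proj₁ ps₁ ps₃) (∈ₚ.∈-map⁺ proj₁ p∈))
           (∈ₚ.∈-map⁺ proj₁ q∈) (∈ₚ.∈-map⁺ proj₁ r∈)
  ... | h , h′ | g , g′ | i , i′ = trans (sym h) (trans i g) , trans (sym h′) (trans i′ g′)

-- An entry outside `c` lies either outside `b`, where `I` applies, or in the rest of `b`, where `J`
-- applies.
Has-nested : Interval u b v → Has z b → Has z (u ++ b ++ v)
Has-nested {u} {_} {v} I (has {p} {c} {q} refl shape J) = has {before = u ++ p} {c} {q ++ v} regroup shape (uniform I′)
  where
  regroup : u ++ (p ++ c ++ q) ++ v ≡ (u ++ p) ++ c ++ q ++ v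
  regroup = trans (cong (u ++_) (trans (Listₚ.++-assoc p (c ++ q) v) (cong (p ++_) (Listₚ.++-assoc c q v))))
                  (sym (Listₚ.++-assoc u p _))
  inner : c ⊆ p ++ c ++ q
  inner = Subₚ.++⁺ˡ p (Subₚ.++⁺ʳ q ⊆-refl)
  I′ : ∀ {e x y} → e ∈ (u ++ p) ++ q ++ v → x ∈ c → y ∈ c → SameSide e x y
  I′ e∈ x∈ y∈ with ∈ₚ.∈-++⁻ (u ++ p) e∈
  ... | inj₁ e∈up with ∈ₚ.∈-++⁻ u e∈up
  ...   | inj₁ e∈u = side I (∈ₚ.∈-++⁺ˡ e∈u) (Sub.lookup inner x∈) (Sub.lookup inner y∈)
  ...   | inj₂ e∈p = side J (∈ₚ.∈-++⁺ˡ e∈p) x∈ y∈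
  I′ e∈ x∈ y∈ | inj₂ e∈qv with ∈ₚ.∈-++⁻ q e∈qv
  ...   | inj₁ e∈q = side J (∈ₚ.∈-++⁺ʳ p e∈q) x∈ y∈
  ...   | inj₂ e∈v = side I (∈ₚ.∈-++⁺ʳ u e∈v) (Sub.lookup inner x∈) (Sub.lookup inner y∈)

Has-trans : Has b z → Has z s → Has b s
Has-trans h (has refl shape I) = Has-nested I (Has-resp-≅ (≅-sym shape) h)

_≲_ : List ℕ → List ℕ → Set
s ≲ r = ∃ λ t → t ⊆ r × s ≅ t

≲-trans : s ≲ t → t ≲ u → s ≲ u
≲-trans (s′ , s′⊆ , e) (t′ , t′⊆ , f) with ≅-⊆ f s′⊆
... | s″ , s″⊆ , g = s″ , ⊆-trans s″⊆ t′⊆ , ≅-trans e g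

⊆⇒≲ : s ⊆ t → s ≲ t
⊆⇒≲ p = _ , p , ≅-refl

≅⇒≲ : s ≅ t → s ≲ t
≅⇒≲ e = _ , ⊆-refl , e

Exception : List (List ℕ) → List ℕ → Set
Exception E s = Any (λ z → Has z s) E

-- `E` accounts for the patterns of `x` that are not patterns of `y`, each through some interval
-- that it contains.
Shrinks : List (List ℕ) → List ℕ → List ℕ → Set
Shrinks E x y = ∀ {s} → s ⊆ x → s ≲ y ⊎ Exception E s

Shrinks-resp-≅ : ∀ {E x y x′ y′} → x ≅ x′ → y ≅ y′ → Shrinks E x′ y′ → Shrinks E x y
Shrinks-resp-≅ e f S s⊆ with ≅-⊆ e s⊆
... | s′ , s′⊆ , g with S s′⊆
...   | inj₁ p = inj₁ (≲-trans (≅⇒≲ g) (≲-trans p (≅⇒≲ (≅-sym f))))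
...   | inj₂ p = inj₂ (Any.map (Has-resp-≅ (≅-sym g)) p)

-- An embedding of `s` splits into three parts. Either the middle part also embeds into `y`, and
-- `exchange` moves it there, or it has an exceptional interval, which is then nested in `s`.
shrink : ∀ {E x y} → Interval u b v → x ⊆ b → y ⊆ b → Shrinks E x y →
         s ≲ u ++ x ++ v → s ≲ u ++ y ++ v ⊎ Exception E s
shrink {u} {v = v} {x = x} {y} I x⊆ y⊆ S (t , t⊆ , e) with split-⊆ u t⊆
... | u′ , _ , refl , u′⊆ , q with split-⊆ x q
... | x′ , v′ , refl , x′⊆ , v′⊆ with S x′⊆
...   | inj₁ (y′ , y′⊆ , f) = inj₁ (u′ ++ y′ ++ v′ , Subₚ.++⁺ u′⊆ (Subₚ.++⁺ y′⊆ v′⊆) ,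
          ≅-trans e (exchange I u′⊆ v′⊆ (⊆-trans x′⊆ x⊆) (⊆-trans y′⊆ y⊆) f))
...   | inj₂ p = inj₂ (Any.map (λ h → Has-resp-≅ (≅-sym e) (Has-nested (Interval-⊆ I u′⊆ (⊆-trans x′⊆ x⊆) v′⊆) h)) p)

-- Enumeration of subsequences, and tables decided by evaluation

subs-sound : ∀ xs → s ∈ subs xs → s ⊆ xs
subs-sound []       (here refl) = []
subs-sound (x ∷ xs) p with ∈ₚ.∈-++⁻ (map (x ∷_) (subs xs)) p
... | inj₁ q with ∈ₚ.∈-map⁻ (x ∷_) q
...   | t , t∈ , refl = refl ∷ subs-sound xs t∈
subs-sound (x ∷ xs) p | inj₂ q = x ∷ʳ subs-sound xs q

subs-complete : s ⊆ xs → s ∈ subs xs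
subs-complete []         = here refl
subs-complete {xs = x ∷ xs} (_ ∷ʳ p)   = ∈ₚ.∈-++⁺ʳ (map (x ∷_) (subs xs)) (subs-complete p)
subs-complete (refl ∷ p) = ∈ₚ.∈-++⁺ˡ (∈ₚ.∈-map⁺ _ (subs-complete p))

∈patterns⇒≲ : ∀ xs → st s ∈ patterns xs → s ≲ xs
∈patterns⇒≲ xs p with ∈ₚ.∈-map⁻ st p
... | t , t∈ , e = t , subs-sound xs t∈ , st≡⇒≅ e

≲⇒∈patterns : s ≲ xs → st s ∈ patterns xs
≲⇒∈patterns (t , t⊆ , e) = subst (_∈ _) (sym (≅⇒st≡ e)) (∈ₚ.∈-map⁺ st (subs-complete t⊆))

-- A form of `Has` with explicit start `k`, in which every clause is decidable.
OccursAt : List ℕ → List ℕ → ℕ → Set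
OccursAt z s k = let m = length z ; b = take m (drop k s) ; v = drop m (drop k s) in
  st b ≡ st z × All (λ e → All (λ x → All (λ y → SameSide e x y) b) b) (take k s ++ v)

occursAt? : ∀ z s k → Dec (OccursAt z s k)
occursAt? z s k = (_ ≟L _) ×-dec All.all? (λ e → All.all? (λ x → All.all? (λ y →
  ((e <ᵇ x) Boolₚ.≟ (e <ᵇ y)) ×-dec ((x <ᵇ e) Boolₚ.≟ (y <ᵇ e))) _) _) _

Occurs : List ℕ → List ℕ → Set
Occurs z s = Any (OccursAt z s) (upTo (suc (length s)))

occurs? : ∀ z s → Dec (Occurs z s)
occurs? z s = Any.any? (occursAt? z s) _

occurs⇒has : Occurs z s → Has z s
occurs⇒has {z} {s} p with Any.satisfied p
... | k , e , I = has {before = take k s}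
  (sym (trans (cong (take k s ++_) (Listₚ.take++drop≡id (length z) (drop k s))) (Listₚ.take++drop≡id k s)))
  (st≡⇒≅ e) (uniform λ e∈ x∈ y∈ → All.lookup (All.lookup (All.lookup I e∈) x∈) y∈)

ShrinkTable : List (List ℕ) → List ℕ → List ℕ → Set
ShrinkTable E x y = All (λ s → st s ∈ patterns y ⊎ Any (λ z → Occurs z s) E) (subs x)

shrinks? : ∀ E x y → Dec (ShrinkTable E x y)
shrinks? E x y = All.all? (λ s → (st s ∈? patterns y) ⊎-dec Any.any? (λ z → occurs? z s) E) _

shrinks : ∀ {E x y} → ShrinkTable E x y → Shrinks E x y
shrinks {y = y} t s⊆ with All.lookup t (subs-complete s⊆)
... | inj₁ p = inj₁ (∈patterns⇒≲ y p)
... | inj₂ p = inj₂ (Any.map occurs⇒has p)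

-- The Möbius function as a solution of linear equations

∑ : {A : Set} → List A → (A → ℤ) → ℤ
∑ as f = sumℤ (map f as)

module _ {A : Set} where

  ∑-cong : ∀ (as : List A) {f g} → (∀ {a} → a ∈ as → f a ≡ g a) → ∑ as f ≡ ∑ as g
  ∑-cong []       h = refl
  ∑-cong (a ∷ as) h = cong₂ _+ᶻ_ (h (here refl)) (∑-cong as (h ∘ there))

  ∑-zero : ∀ (as : List A) {f} → (∀ {a} → a ∈ as → f a ≡ 0ℤ) → ∑ as f ≡ 0ℤ
  ∑-zero []       h = refl
  ∑-zero (a ∷ as) h = cong₂ _+ᶻ_ (h (here refl)) (∑-zero as (h ∘ there))

  ∑-single : ∀ {as : List A} {a f} → Unique as → a ∈ as → (∀ {b} → b ∈ as → b ≢ a → f b ≡ 0ℤ) → ∑ as f ≡ f a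
  ∑-single {_ ∷ as} {a} {f} (h ∷ _) (here refl) z =
    trans (cong (f a +ᶻ_) (∑-zero as (λ p → z (there p) (All.lookup h p ∘ sym)))) (ℤₚ.+-identityʳ (f a))
  ∑-single {b ∷ as} {a} {f} (h ∷ u) (there p) z =
    trans (cong₂ _+ᶻ_ (z (here refl) (All.lookup h p)) (∑-single u p (z ∘ there))) (ℤₚ.+-identityˡ (f a))

  ∑-+ : ∀ (as : List A) f g → ∑ as (λ a → f a +ᶻ g a) ≡ ∑ as f +ᶻ ∑ as g
  ∑-+ []       f g = refl
  ∑-+ (a ∷ as) f g = trans (cong (f a +ᶻ g a +ᶻ_) (∑-+ as f g)) (interchange (f a) (g a) (∑ as f) (∑ as g))

  ∑-neg : ∀ (as : List A) f → ∑ as (λ a → -ᶻ f a) ≡ -ᶻ ∑ as f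
  ∑-neg []       f = refl
  ∑-neg (a ∷ as) f = trans (cong (-ᶻ f a +ᶻ_) (∑-neg as f)) (sym (ℤₚ.neg-distrib-+ (f a) (∑ as f)))

  ∑-filter : ∀ {P : A → Set} (P? : Decidable P) (as : List A) {f} → (∀ {a} → a ∈ as → ¬ P a → f a ≡ 0ℤ) →
             ∑ (filter P? as) f ≡ ∑ as f
  ∑-filter P? []       h = refl
  ∑-filter P? (a ∷ as) {f} h with P? a
  ... | yes _ = cong (f a +ᶻ_) (∑-filter P? as (h ∘ there))
  ... | no ¬p = trans (∑-filter P? as (h ∘ there)) (sym (trans (cong (_+ᶻ ∑ as f) (h (here refl) ¬p)) (ℤₚ.+-identityˡ _)))

  ∑-↭ : ∀ {as bs : List A} f → as ↭ bs → ∑ as f ≡ ∑ bs f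
  ∑-↭ f Perm.refl          = refl
  ∑-↭ f (Perm.prep a p)    = cong (f a +ᶻ_) (∑-↭ f p)
  ∑-↭ {bs = b ∷ a ∷ bs} f (Perm.swap a b p) =
    trans (cong (λ n → f a +ᶻ (f b +ᶻ n)) (∑-↭ f p)) (x∙yz≈y∙xz (f a) (f b) (∑ bs f))
  ∑-↭ f (Perm.trans p q)   = trans (∑-↭ f p) (∑-↭ f q)

  ∑-set : ∀ {as bs : List A} f → Unique as → Unique bs → (∀ {a} → a ∈ as → a ∈ bs) → (∀ {a} → a ∈ bs → a ∈ as) →
          ∑ as f ≡ ∑ bs f
  ∑-set f u u′ to from = ∑-↭ f (∼bag⇒↭ (unique∧set⇒bag u u′ (mk⇔ to from)))

elem⇒∈ : ∀ xs yss → elem xs yss ≡ true → xs ∈ yss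
elem⇒∈ xs (ys ∷ yss) e with xs ≟L ys
... | yes p = here p
... | no _  = there (elem⇒∈ xs yss e)

∈⇒elem : ∀ {xs} yss → xs ∈ yss → elem xs yss ≡ true
∈⇒elem {xs} (ys ∷ yss) p with xs ≟L ys
... | yes _ = refl
... | no xs≢ys with p
...   | here e  = ⊥-elim (xs≢ys e)
...   | there q = ∈⇒elem yss q

∈-dedup⁻ : ∀ xss → xs ∈ dedup xss → xs ∈ xss
∈-dedup⁻ (ys ∷ xss) p with elem ys xss | p
... | true  | q       = there (∈-dedup⁻ xss q)
... | false | here e  = here e
... | false | there q = there (∈-dedup⁻ xss q)

∈-dedup⁺ : ∀ xss → xs ∈ xss → xs ∈ dedup xss
∈-dedup⁺ (ys ∷ xss) p with elem ys xss in eq | p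
... | true  | here refl = ∈-dedup⁺ xss (elem⇒∈ ys xss eq)
... | true  | there q   = ∈-dedup⁺ xss q
... | false | here e    = here e
... | false | there q   = there (∈-dedup⁺ xss q)

dedup-unique : ∀ xss → Unique (dedup xss)
dedup-unique [] = []
dedup-unique (xs ∷ xss) with elem xs xss in eq
... | true  = dedup-unique xss
... | false = All.tabulate (λ p e → case-true (trans (sym eq) (∈⇒elem xss (subst (_∈ xss) (sym e) (∈-dedup⁻ xss p)))))
              ∷ dedup-unique xss
  where
  case-true : false ≢ true
  case-true ()

below : List ℕ → List (List ℕ)
below π = dedup (patterns π)

below-unique : ∀ π → Unique (below π)
below-unique π = dedup-unique (patterns π)

𝟙 : List ℕ
𝟙 = 0 ∷ []

-- Standardising first allows subsequences to be used as they stand, without relabelling.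
M : List ℕ → ℤ
M s = μ 𝟙 (st s)

≲⇒∈below : s ≲ π → st s ∈ below π
≲⇒∈below p = ∈-dedup⁺ _ (≲⇒∈patterns p)

∈below⇒ : ∀ π → xs ∈ below π → ∃ λ s → s ⊆ π × xs ≡ st s
∈below⇒ π p with ∈ₚ.∈-map⁻ st (∈-dedup⁻ (patterns π) p)
... | s , s∈ , e = s , subs-sound π s∈ , e

⊆-length⇒≡ : ∀ {s xs : List ℕ} → s ⊆ xs → length xs ≤ length s → s ≡ xs
⊆-length⇒≡ []         _       = refl
⊆-length⇒≡ (_ ∷ʳ p)   h       = ⊥-elim (ℕₚ.<-irrefl refl (ℕₚ.≤-trans h (Subₚ.length-mono-≤ p)))
⊆-length⇒≡ (refl ∷ p) (s≤s h) = cong (_ ∷_) (⊆-length⇒≡ p h)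

≢⇒shorter : s ⊆ π → st s ≢ st π → length s < length π
≢⇒shorter {s} {π} p ne with ℕₚ.<-≤-connex (length s) (length π)
... | inj₁ h = h
... | inj₂ h = ⊥-elim (ne (cong st (⊆-length⇒≡ p h)))

proper : ∀ {τ} → st π ≡ π → τ ∈ properPatterns π → ∃ λ s → τ ≡ st s × length τ < length π
proper {π} {τ} std p with ∈ₚ.∈-filter⁻ (λ τ → ¬? (τ ≟L π)) {xs = below π} p
... | q , τ≢π with ∈below⇒ π q
...   | s , s⊆ , refl = s , refl , subst (_< length π) (sym (length-st s)) (≢⇒shorter s⊆ (λ e → τ≢π (trans e std)))

-- Recursive calls are at strictly shorter permutations, so fuel exceeding the length never runs
-- out.
muF-fuel : ∀ k l {π} → st π ≡ π → length π < k → length π < l → muF k 𝟙 π ≡ muF l 𝟙 π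
muF-fuel (suc k) (suc l) {π} std (s≤s p) (s≤s q) with 𝟙 ≟L π
... | yes _ = refl
... | no _  = cong (λ n → if contains 𝟙 π then -ᶻ n else 0ℤ) (∑-cong _ same)
  where
  same : ∀ {τ} → τ ∈ filter (λ τ → contains 𝟙 τ Boolₚ.≟ true) (properPatterns π) → muF k 𝟙 τ ≡ muF l 𝟙 τ
  same τ∈ with proper std (proj₁ (∈ₚ.∈-filter⁻ (λ τ → contains 𝟙 τ Boolₚ.≟ true) {xs = properPatterns π} τ∈))
  ... | s , refl , h = muF-fuel k l (st-idem s) (ℕₚ.<-≤-trans h p) (ℕₚ.<-≤-trans h q)

contains-𝟙 : ∀ x xs → contains 𝟙 (x ∷ xs) ≡ true
contains-𝟙 x xs = ∈⇒elem (patterns (x ∷ xs))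
  (subst (_∈ patterns (x ∷ xs)) (cong (λ b → ((if b then 1 else 0) + 0) ∷ []) (n≮ᵇn x))
    (≲⇒∈patterns {s = x ∷ []} (⊆⇒≲ (refl ∷ Sub.minimum xs))))

-- Only the empty permutation avoids `𝟙`. The lists of patterns include it, and its value zero
-- allows summing over them without a filter.
μ-𝟙-without : ∀ π → ¬ contains 𝟙 π ≡ true → μ 𝟙 π ≡ 0ℤ
μ-𝟙-without []       h = refl
μ-𝟙-without (x ∷ xs) h = ⊥-elim (h (contains-𝟙 x xs))

μ-recursion : st π ≡ π → 2 ≤ length π → μ 𝟙 π ≡ -ᶻ ∑ (properPatterns π) (μ 𝟙)
μ-recursion {π@(x ∷ y ∷ xs)} std (s≤s (s≤s h)) with 𝟙 ≟L π
... | no _ rewrite contains-𝟙 x (y ∷ xs) = cong -ᶻ_ (begin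
  ∑ (filter _ (properPatterns π)) (muF (length π) 𝟙) ≡⟨ ∑-cong _ same ⟩
  ∑ (filter _ (properPatterns π)) (μ 𝟙)
    ≡⟨ ∑-filter (λ τ → contains 𝟙 τ Boolₚ.≟ true) (properPatterns π) (λ {τ} _ → μ-𝟙-without τ) ⟩
  ∑ (properPatterns π) (μ 𝟙)                         ∎)
  where
  open ≡-Reasoning
  same : ∀ {τ} → τ ∈ filter (λ τ → contains 𝟙 τ Boolₚ.≟ true) (properPatterns π) → muF (length π) 𝟙 τ ≡ μ 𝟙 τ
  same τ∈ with proper {π} std (proj₁ (∈ₚ.∈-filter⁻ (λ τ → contains 𝟙 τ Boolₚ.≟ true) {xs = properPatterns π} τ∈))
  ... | s , refl , h = muF-fuel _ _ (st-idem s) h ℕₚ.≤-refl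

-- `below π` consists of `π` and its proper patterns, whose contributions cancel by the recursion.
-- The length bound excludes `𝟙`, where the sum is 1.
∑-below-standard : st π ≡ π → 2 ≤ length π → ∑ (below π) (μ 𝟙) ≡ 0ℤ
∑-below-standard {π} std h = begin
  ∑ (below π) (μ 𝟙)                                                    ≡⟨ ∑-set (μ 𝟙) (below-unique π) unique to from ⟩
  μ 𝟙 π +ᶻ ∑ (properPatterns π) (μ 𝟙)
    ≡⟨ cong (_+ᶻ ∑ (properPatterns π) (μ 𝟙)) (μ-recursion std h) ⟩
  -ᶻ ∑ (properPatterns π) (μ 𝟙) +ᶻ ∑ (properPatterns π) (μ 𝟙)        ≡⟨ ℤₚ.+-inverseˡ (∑ (properPatterns π) (μ 𝟙)) ⟩
  0ℤ                                                                   ∎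
  where
  open ≡-Reasoning
  proper? : Decidable (_≢ π)
  proper? τ = ¬? (τ ≟L π)
  unique : Unique (π ∷ properPatterns π)
  unique = All.map (λ ne e → ne (sym e)) (Allₚ.all-filter proper? (below π)) ∷ Uniqueₚ.filter⁺ proper? (below-unique π)
  to : ∀ {τ} → τ ∈ below π → τ ∈ π ∷ properPatterns π
  to {τ} p with τ ≟L π
  ... | yes e = here e
  ... | no ne = there (∈ₚ.∈-filter⁺ proper? p ne)
  from : ∀ {τ} → τ ∈ π ∷ properPatterns π → τ ∈ below π
  from (here refl) = subst (_∈ below π) std (≲⇒∈below (⊆⇒≲ ⊆-refl))
  from (there p)   = proj₁ (∈ₚ.∈-filter⁻ proper? {xs = below π} p)

below-mono : ρ ≲ π → xs ∈ below ρ → xs ∈ below π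
below-mono {ρ} p q with ∈below⇒ ρ q
... | s , s⊆ , refl = ≲⇒∈below (≲-trans (⊆⇒≲ s⊆) p)

∑-below : 2 ≤ length π → ∑ (below π) (μ 𝟙) ≡ 0ℤ
∑-below {π} h = trans
  (∑-set (μ 𝟙) (below-unique π) (below-unique (st π)) (below-mono (≅⇒≲ (≅-st π))) (below-mono (≅⇒≲ (≅-sym (≅-st π)))))
  (∑-below-standard (st-idem π) (subst (2 ≤_) (sym (length-st π)) h))

-- Combinations of indicators of ideals

ι : List ℕ → List ℕ → ℤ
ι τ ρ = if does (τ ∈? patterns ρ) then 1ℤ else 0ℤ

ι-in : ∀ s ρ → s ≲ ρ → ι (st s) ρ ≡ 1ℤ
ι-in s ρ p with st s ∈? patterns ρ
... | yes _ = refl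
... | no ¬p = ⊥-elim (¬p (≲⇒∈patterns p))

ι-out : ∀ s ρ → ¬ s ≲ ρ → ι (st s) ρ ≡ 0ℤ
ι-out s ρ ¬p with st s ∈? patterns ρ
... | yes p = ⊥-elim (¬p (∈patterns⇒≲ ρ p))
... | no _  = refl

ι-longer : ∀ s ρ → length ρ < length s → ι (st s) ρ ≡ 0ℤ
ι-longer s ρ h = ι-out s ρ λ (t , t⊆ , e) → ℕₚ.<⇒≱ h (subst (_≤ length ρ) (sym (≅-length e)) (Subₚ.length-mono-≤ t⊆))

_≲?_ : ∀ s ρ → Dec (s ≲ ρ)
s ≲? ρ with st s ∈? patterns ρ
... | yes p = yes (∈patterns⇒≲ ρ p)
... | no ¬p = no (¬p ∘ ≲⇒∈patterns)

record Balanced (π : List ℕ) (f : List ℕ → ℤ) : Set where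
  constructor balanced
  field
    total : ∑ (below π) (λ τ → f τ *ᶻ μ 𝟙 τ) ≡ 0ℤ
open Balanced

-- The indicator cuts the sum over `below π` down to `below ρ`, where `∑-below` applies.
balanced-ι : ρ ≲ π → 2 ≤ length ρ → Balanced π (λ τ → ι τ ρ)
balanced-ι {ρ} {π} p h = balanced (begin
  ∑ (below π) (λ τ → ι τ ρ *ᶻ μ 𝟙 τ)                         ≡⟨ sym (∑-filter (_∈? patterns ρ) (below π) (λ _ → outside)) ⟩
  ∑ (filter (_∈? patterns ρ) (below π)) (λ τ → ι τ ρ *ᶻ μ 𝟙 τ) ≡⟨ ∑-cong _ inside ⟩
  ∑ (filter (_∈? patterns ρ) (below π)) (μ 𝟙)
    ≡⟨ ∑-set (μ 𝟙) (Uniqueₚ.filter⁺ (_∈? patterns ρ) (below-unique π)) (below-unique ρ) to from ⟩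
  ∑ (below ρ) (μ 𝟙)                                           ≡⟨ ∑-below {ρ} h ⟩
  0ℤ                                                          ∎)
  where
  open ≡-Reasoning
  outside : ∀ {τ} → τ ∉ patterns ρ → ι τ ρ *ᶻ μ 𝟙 τ ≡ 0ℤ
  outside {τ} τ∉ with τ ∈? patterns ρ
  ... | yes q = ⊥-elim (τ∉ q)
  ... | no _  = ℤₚ.*-zeroˡ (μ 𝟙 τ)
  inside : ∀ {τ} → τ ∈ filter (_∈? patterns ρ) (below π) → ι τ ρ *ᶻ μ 𝟙 τ ≡ μ 𝟙 τ
  inside {τ} τ∈ with τ ∈? patterns ρ
  ... | yes _ = ℤₚ.*-identityˡ (μ 𝟙 τ)
  ... | no ¬q = ⊥-elim (¬q (proj₂ (∈ₚ.∈-filter⁻ (_∈? patterns ρ) {xs = below π} τ∈)))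
  to : ∀ {τ} → τ ∈ filter (_∈? patterns ρ) (below π) → τ ∈ below ρ
  to τ∈ = ∈-dedup⁺ _ (proj₂ (∈ₚ.∈-filter⁻ (_∈? patterns ρ) {xs = below π} τ∈))
  from : ∀ {τ} → τ ∈ below ρ → τ ∈ filter (_∈? patterns ρ) (below π)
  from τ∈ = ∈ₚ.∈-filter⁺ (_∈? patterns ρ) (below-mono p τ∈) (∈-dedup⁻ _ τ∈)

balanced-+ : ∀ {f g} → Balanced π f → Balanced π g → Balanced π (λ τ → f τ +ᶻ g τ)
balanced-+ {π} {f} {g} p q = balanced (trans (∑-cong (below π) (λ {τ} _ → ℤₚ.*-distribʳ-+ (μ 𝟙 τ) (f τ) (g τ)))
  (trans (∑-+ (below π) _ _) (cong₂ _+ᶻ_ (total p) (total q))))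

balanced-neg : ∀ {f} → Balanced π f → Balanced π (λ τ → -ᶻ f τ)
balanced-neg {π} {f} p = balanced (trans (∑-cong (below π) (λ {τ} _ → sym (ℤₚ.neg-distribˡ-* (f τ) (μ 𝟙 τ))))
  (trans (∑-neg (below π) _) (cong -ᶻ_ (total p))))

balanced-- : ∀ {f g} → Balanced π f → Balanced π g → Balanced π (λ τ → f τ -ᶻ g τ)
balanced-- p q = balanced-+ p (balanced-neg q)

-- All terms of the balanced sum except the one at `π` are zero, so the sum equals `M π`.
vanishing : ∀ {f} → 2 ≤ length π → Balanced π f → f (st π) ≡ 1ℤ →
            (∀ {s} → s ⊆ π → length s < length π → M s ≡ 0ℤ ⊎ f (st s) ≡ 0ℤ) → M π ≡ 0ℤ
vanishing {π} {f} h bal top rest = begin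
  M π                                  ≡⟨ sym (ℤₚ.*-identityˡ (M π)) ⟩
  1ℤ *ᶻ M π                           ≡⟨ cong (_*ᶻ M π) (sym top) ⟩
  f (st π) *ᶻ μ 𝟙 (st π)              ≡⟨ sym (∑-single (below-unique π) (≲⇒∈below (⊆⇒≲ ⊆-refl)) zero-elsewhere) ⟩
  ∑ (below π) (λ τ → f τ *ᶻ μ 𝟙 τ)    ≡⟨ total bal ⟩
  0ℤ                                   ∎
  where
  open ≡-Reasoning
  zero-elsewhere : ∀ {τ} → τ ∈ below π → τ ≢ st π → f τ *ᶻ μ 𝟙 τ ≡ 0ℤ
  zero-elsewhere τ∈ ne with ∈below⇒ π τ∈
  ... | s , s⊆ , refl with rest s⊆ (≢⇒shorter s⊆ ne)
  ...   | inj₁ e = trans (cong (f (st s) *ᶻ_) e) (ℤₚ.*-zeroʳ (f (st s)))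
  ...   | inj₂ e = trans (cong (_*ᶻ M s) e) (ℤₚ.*-zeroˡ (M s))

-- Intervals of incompatible shapes are disjoint

at : List ℕ → ℕ → ℕ
at []       _       = 0
at (x ∷ xs) zero    = x
at (x ∷ xs) (suc i) = at xs i

at-++ˡ : ∀ xs {ys i} → i < length xs → at (xs ++ ys) i ≡ at xs i
at-++ˡ (x ∷ xs) {i = zero}  _       = refl
at-++ˡ (x ∷ xs) {i = suc i} (s≤s p) = at-++ˡ xs p

at-++ʳ : ∀ xs {ys i} → at (xs ++ ys) (length xs + i) ≡ at ys i
at-++ʳ []       = refl
at-++ʳ (x ∷ xs) = at-++ʳ xs

at-∈ : ∀ xs {i} → i < length xs → at xs i ∈ xs
at-∈ (x ∷ xs) {zero}  _       = here refl
at-∈ (x ∷ xs) {suc i} (s≤s p) = there (at-∈ xs p)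

at-pairs : ∀ ps {i} → i < length ps → ∃ λ p → p ∈ ps × at (map proj₁ ps) i ≡ proj₁ p × at (map proj₂ ps) i ≡ proj₂ p
at-pairs (p ∷ ps) {zero}  _       = p , here refl , refl , refl
at-pairs (p ∷ ps) {suc i} (s≤s h) = let q , q∈ , e , f = at-pairs ps h in q , there q∈ , e , f

less : List ℕ → ℕ → ℕ → Bool
less xs i j = at xs i <ᵇ at xs j

≅-less : xs ≅ ys → ∀ {i j} → i < length ys → j < length ys → less xs i j ≡ less ys i j
≅-less (zipped ps refl refl o) {i} {j} i< j<
  with at-pairs ps {i} (subst (i <_) (Listₚ.length-map proj₂ ps) i<)
     | at-pairs ps {j} (subst (j <_) (Listₚ.length-map proj₂ ps) j<)
... | p , p∈ , e , e′ | q , q∈ , f , f′ rewrite e | e′ | f | f′ = proj₁ (orders-∈ o p∈ q∈)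

-- `Has` in coordinates, starting at position `p`, so that two overlapping occurrences can be
-- compared entry by entry.
record Window (z s : List ℕ) (p : ℕ) : Set where
  field
    fits    : p + length z ≤ length s
    like    : ∀ {i j} → i < length z → j < length z → less s (p + i) (p + j) ≡ less z i j
    outside : ∀ {e i j} → e < length s → e < p ⊎ p + length z ≤ e → i < length z → j < length z →
              SameSide (at s e) (at s (p + i)) (at s (p + j))

window : (h : Has z s) → Window z s (length (Has.before h))
window {z} (has {u} {b} {v} refl shape I) = record
  { fits    = subst (λ n → length u + n ≤ length (u ++ b ++ v)) same
                (subst (length u + length b ≤_) (sym (trans (Listₚ.length-++ u) (cong (length u +_) (Listₚ.length-++ b))))
                  (ℕₚ.+-monoʳ-≤ (length u) (ℕₚ.m≤m+n _ _)))
  ; like    = λ {i} {j} i< j< → trans (cong₂ _<ᵇ_ (middle i<) (middle j<)) (≅-less shape i< j<)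
  ; outside = λ {e} {i} {j} e< out i< j< → subst₂ (SameSide (at l e)) (sym (middle i<)) (sym (middle j<))
                (Interval.side I (side-∈ e< out) (at-∈ b (fit i<)) (at-∈ b (fit j<)))
  }
  where
  l = u ++ b ++ v
  same : length b ≡ length z
  same = ≅-length shape
  fit : ∀ {i} → i < length z → i < length b
  fit = subst (_ <_) (sym same)
  middle : ∀ {i} → i < length z → at l (length u + i) ≡ at b i
  middle i< = trans (at-++ʳ u) (at-++ˡ b (fit i<))
  side-∈ : ∀ {e} → e < length l → e < length u ⊎ length u + length z ≤ e → at l e ∈ u ++ v
  side-∈ e< (inj₁ p) = subst (_∈ u ++ v) (sym (at-++ˡ u p)) (∈ₚ.∈-++⁺ˡ (at-∈ u p))
  side-∈ {e} e< (inj₂ p) = subst (_∈ u ++ v) (sym (trans (cong (at l) position) (trans (at-++ʳ u) (at-++ʳ b))))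
      (∈ₚ.∈-++⁺ʳ u (at-∈ v (ℕₚ.+-cancelˡ-< (length b) _ _ (ℕₚ.+-cancelˡ-< (length u) _ _
        (subst₂ _<_ position (trans (Listₚ.length-++ u) (cong (length u +_) (Listₚ.length-++ b))) e<)))))
    where
    e′ = e ∸ (length u + length z)
    position : e ≡ length u + (length b + e′)
    position = trans (sym (ℕₚ.m+[n∸m]≡n p)) (trans (ℕₚ.+-assoc (length u) (length z) e′)
      (cong (λ n → length u + (n + e′)) (sym same)))

-- Reasons why intervals of shapes z₁ and z₂ cannot start at positions p and p + d, respectively;
-- i indexes a common entry of the two intervals, as an entry of z₂.
module _ (z₁ z₂ : List ℕ) (d : ℕ) where

  Common : ℕ → Set
  Common i = i < length z₂ × d + i < length z₁

  common? : ∀ i → Dec (Common i)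
  common? i = (i <? length z₂) ×-dec (d + i <? length z₁)

  -- The alternatives, in order: the shapes order two common entries differently; an entry only in
  -- the first interval separates two common entries; an entry of the second interval past the end
  -- of the first does so; or, with `i` common, `k` before the second interval and `j` past the
  -- first, the forced agreement of the truth values of `k < i`, `k < j` and `i < j` fails.
  Clash : ℕ → ℕ → ℕ → Set
  Clash i j k =
    (Common j × less z₁ (d + i) (d + j) ≢ less z₂ i j) ⊎
    ((k < length z₁ × (k < d ⊎ d + length z₂ ≤ k)) × Common j × less z₁ k (d + i) ≢ less z₁ k (d + j)) ⊎
    ((k < length z₂ × length z₁ ≤ d + k) × Common j × less z₂ k i ≢ less z₂ k j) ⊎
    (k < d × (j < length z₂ × length z₁ ≤ d + j) × less z₁ k (d + i) ≢ less z₂ i j)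

  clash? : ∀ i j k → Dec (Clash i j k)
  clash? i j k =
    (common? j ×-dec ¬? (_ Boolₚ.≟ _)) ⊎-dec
    (((k <? _) ×-dec ((k <? d) ⊎-dec (_ ≤? k))) ×-dec common? j ×-dec ¬? (_ Boolₚ.≟ _)) ⊎-dec
    (((k <? _) ×-dec (_ ≤? d + k)) ×-dec common? j ×-dec ¬? (_ Boolₚ.≟ _)) ⊎-dec
    ((k <? d) ×-dec ((j <? _) ×-dec (_ ≤? d + j)) ×-dec ¬? (_ Boolₚ.≟ _))

  Clashing : Set
  Clashing = Any (λ i → Common i × Any (λ j → Any (Clash i j) range) range) range
    where range = upTo (length z₁ + length z₂)

  clashing? : Dec Clashing
  clashing? = Any.any? (λ i → common? i ×-dec Any.any? (λ j → Any.any? (clash? i j) _) _) _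

  no-clash : ∀ {p} → Window z₁ s p → Window z₂ s (p + d) → d < length z₁ → ∀ {i j k} → Common i → ¬ Clash i j k
  no-clash {s} {p} W₁ W₂ d< {i} {j} {k} (i₂ , i₁) = λ where
      (inj₁ ((j₂ , j₁) , ne)) → ne (trans (sym (like W₁ i₁ j₁)) (trans (cong₂ (less s) (shift i) (shift j)) (like W₂ i₂ j₂)))
      (inj₂ (inj₁ ((k< , far) , (j₂ , j₁) , ne))) → ne (trans (sym (like W₁ k< i₁)) (trans
        (subst₂ (λ a b → less s (p + k) a ≡ less s (p + k) b) (sym (shift i)) (sym (shift j))
          (proj₁ (outside W₂ (ℕₚ.<-≤-trans (ℕₚ.+-monoʳ-< p k<) (fits W₁))
            (Sum.map (ℕₚ.+-monoʳ-< p) (λ h → subst (_≤ p + k) (sym (ℕₚ.+-assoc p d _)) (ℕₚ.+-monoʳ-≤ p h)) far) i₂ j₂)))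
        (like W₁ k< j₁)))
      (inj₂ (inj₂ (inj₁ ((k< , far) , (j₂ , j₁) , ne)))) → ne (trans (sym (like W₂ k< i₂)) (trans
        (subst₂ (λ a b → less s (p + d + k) a ≡ less s (p + d + k) b) (shift i) (shift j)
          (proj₁ (outside W₁ (ℕₚ.<-≤-trans (ℕₚ.+-monoʳ-< (p + d) k<) (fits W₂)) (inj₂ (beyond far)) i₁ j₁)))
        (like W₂ k< j₂)))
      (inj₂ (inj₂ (inj₂ (k< , (j< , far) , ne)))) → ne (trans (sym (like W₁ (ℕₚ.<-trans k< d<) i₁)) (trans
        (subst (λ a → less s (p + k) a ≡ less s (p + k) (p + d + j)) (sym (shift i))
          (proj₁ (outside W₂ (ℕₚ.<-≤-trans (ℕₚ.+-monoʳ-< p (ℕₚ.<-trans k< d<)) (fits W₁)) (inj₁ (ℕₚ.+-monoʳ-< p k<)) i₂ j<)))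
        (trans (proj₂ (outside W₁ (ℕₚ.<-≤-trans (ℕₚ.+-monoʳ-< (p + d) j<) (fits W₂)) (inj₂ (beyond far))
            (ℕₚ.<-trans k< d<) i₁))
          (trans (cong (λ a → less s a (p + d + j)) (shift i)) (like W₂ i₂ j<)))))
    where
    open Window
    shift : ∀ i → p + (d + i) ≡ p + d + i
    shift i = sym (ℕₚ.+-assoc p d i)
    beyond : ∀ {k} → length z₁ ≤ d + k → p + length z₁ ≤ p + d + k
    beyond {k} h = subst (p + length z₁ ≤_) (shift k) (ℕₚ.+-monoʳ-≤ p h)

  not-overlapping : ∀ {p} → Window z₁ s p → Window z₂ s (p + d) → d < length z₁ → ¬ Clashing
  not-overlapping W₁ W₂ d< c with Any.satisfied c
  ... | i , ci , c′ with Any.satisfied c′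
  ...   | j , c″ with Any.satisfied c″
  ...     | k , cl = no-clash W₁ W₂ d< {i} {j} {k} ci cl

-- The offsets `d < length z₁` are those at which a second interval, starting no earlier than the
-- first, would meet it.
NoOverlap : List ℕ → List ℕ → Set
NoOverlap z₁ z₂ = All (Clashing z₁ z₂) (upTo (length z₁))

Apart : List ℕ → List ℕ → Set
Apart z₁ z₂ = NoOverlap z₁ z₂ × NoOverlap z₂ z₁

apart? : ∀ z₁ z₂ → Dec (Apart z₁ z₂)
apart? z₁ z₂ = All.all? (clashing? z₁ z₂) _ ×-dec All.all? (clashing? z₂ z₁) _

ordered : NoOverlap z₁ z₂ → (h₁ : Has z₁ s) (h₂ : Has z₂ s) → length (Has.before h₁) ≤ length (Has.before h₂) →
          length (Has.before h₁ ++ Has.block h₁) ≤ length (Has.before h₂)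
ordered {z₁} {z₂} {s} apart h₁ h₂ p≤q with ℕₚ.<-≤-connex (length (Has.before h₂) ∸ length (Has.before h₁)) (length z₁)
... | inj₁ d< = ⊥-elim (not-overlapping z₁ z₂ _ (window h₁) (subst (Window z₂ s) (sym (ℕₚ.m+[n∸m]≡n p≤q)) (window h₂)) d<
                  (All.lookup apart (∈ₚ.∈-upTo⁺ d<)))
... | inj₂ n≤ = subst₂ _≤_ (trans (cong (length (Has.before h₁) +_) (sym (≅-length (Has.shape h₁))))
                    (sym (Listₚ.length-++ (Has.before h₁))))
                  (ℕₚ.m+[n∸m]≡n p≤q) (ℕₚ.+-monoʳ-≤ _ n≤)

split-after : ∀ (xs ys : List ℕ) {us vs} → xs ++ us ≡ ys ++ vs → length xs ≤ length ys →
              ∃ λ ws → ys ≡ xs ++ ws × us ≡ ws ++ vs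
split-after []       ys       e _       = ys , refl , e
split-after (x ∷ xs) (y ∷ ys) e (s≤s h) with Listₚ.∷-injective e
... | refl , e′ with split-after xs ys e′ h
...   | ws , refl , e″ = ws , refl , e″

-- Annihilators

-- Returns b if no sublist of b is order isomorphic to k.
pickFrom : List (List ℕ) → List ℕ → List ℕ → List ℕ
pickFrom []         k b = b
pickFrom (s ∷ cs) k b with st s ≟L st k
... | yes _ = s
... | no _  = pickFrom cs k b

pick : List ℕ → List ℕ → List ℕ
pick k b = pickFrom (subs b) k b

pickFrom-∈ : ∀ cs → pickFrom cs k b ∈ cs ⊎ pickFrom cs k b ≡ b
pickFrom-∈ [] = inj₂ refl
pickFrom-∈ {k} (s ∷ cs) with st s ≟L st k
... | yes _ = inj₁ (here refl)
... | no _  = Sum.map there id (pickFrom-∈ cs)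

pick-⊆ : ∀ k b → pick k b ⊆ b
pick-⊆ k b with pickFrom-∈ {k} {b} (subs b)
... | inj₁ p = subs-sound b p
... | inj₂ e = Sub.⊆-reflexive e

pickFrom-≅ : ∀ cs → s ∈ cs → s ≅ k → pickFrom cs k b ≅ k
pickFrom-≅ {k = k} (s ∷ cs) p f with st s ≟L st k
... | yes e = st≡⇒≅ e
... | no ne with p
...   | here refl = ⊥-elim (ne (≅⇒st≡ f))
...   | there q   = pickFrom-≅ cs q f

pick-≅ : k ≲ b → pick k b ≅ k
pick-≅ (s , s⊆ , e) = pickFrom-≅ _ (subs-complete s⊆) (≅-sym e)

-- A sublist of full length is the whole list. Hence resizing to the original shapes returns `π`
-- itself and not just an isomorphic list.
pick-whole : b ≅ z → pick z b ≡ b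
pick-whole {b} {z} e = ⊆-length⇒≡ (pick-⊆ z b)
  (ℕₚ.≤-reflexive (trans (≅-length e) (sym (≅-length (pick-≅ {z} {b} (≅⇒≲ (≅-sym e)))))))

≲-length : x ≲ y → length x ≤ length y
≲-length (_ , t⊆ , e) = subst (_≤ _) (sym (≅-length e)) (Subₚ.length-mono-≤ t⊆)

-- π has disjoint intervals of shapes z₁ and z₂, and resize x y is what remains of π
-- when these are replaced by intervals of shapes x and y, provided that x ≲ z₁ and y ≲ z₂.
record Slots (z₁ z₂ π : List ℕ) : Set where
  field
    resize  : List ℕ → List ℕ → List ℕ
    full    : resize z₁ z₂ ≡ π
    rest    : ℕ
    size    : x ≲ z₁ → y ≲ z₂ → length (resize x y) ≡ rest + (length x + length y)
    shrinkˡ : x ≲ z₁ → x′ ≲ z₁ → Shrinks E x x′ → s ≲ resize x y → s ≲ resize x′ y ⊎ Exception E s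
    shrinkʳ : y ≲ z₂ → y′ ≲ z₂ → Shrinks E y y′ → s ≲ resize x y → s ≲ resize x y′ ⊎ Exception E s

≲⇒shrinks : x ≲ y → Shrinks [] x y
≲⇒shrinks p s⊆ = inj₁ (≲-trans (⊆⇒≲ s⊆) p)

flip : Slots z₁ z₂ π → Slots z₂ z₁ π
flip S = record
  { resize  = λ x y → resize y x
  ; full    = full
  ; rest    = rest
  ; size    = λ {x} {y} p q → trans (size q p) (cong (rest +_) (ℕₚ.+-comm (length y) (length x)))
  ; shrinkˡ = shrinkʳ
  ; shrinkʳ = shrinkˡ
  }
  where open Slots S

blocks : Interval u b (w ++ c ++ v) → Interval (u ++ b ++ w) c v → b ≅ z₁ → c ≅ z₂ → Slots z₁ z₂ (u ++ b ++ w ++ c ++ v)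
blocks {u} {b} {w} {c} {v} {z₁} {z₂} I J e f = record
  { resize  = resize
  ; full    = cong₂ (λ b c → u ++ b ++ w ++ c ++ v) (pick-whole e) (pick-whole f)
  ; rest    = length u + (length w + length v)
  ; size    = λ p q → sizes (pick-≅ (in₁ p)) (pick-≅ (in₂ q))
  ; shrinkˡ = λ {x} {x′} {_} {_} {y} p q S → shrink
      (Interval-⊆ I ⊆-refl ⊆-refl (Subₚ.++⁺ {as = w} ⊆-refl (Subₚ.++⁺ (pick-⊆ y c) ⊆-refl)))
      (pick-⊆ x b) (pick-⊆ x′ b) (Shrinks-resp-≅ (pick-≅ (in₁ p)) (pick-≅ (in₁ q)) S)
  -- The left context of the second block includes the first block, already resized, hence the
  -- regrouping.
  ; shrinkʳ = λ {y} {y′} {E} {s} {x} p q S h → Sum.map₁ (subst (s ≲_) (sym (regroup x y′)))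
      (shrink (Interval-⊆ J (Subₚ.++⁺ {as = u} ⊆-refl (Subₚ.++⁺ (pick-⊆ x b) ⊆-refl)) ⊆-refl ⊆-refl)
        (pick-⊆ y c) (pick-⊆ y′ c) (Shrinks-resp-≅ (pick-≅ (in₂ p)) (pick-≅ (in₂ q)) S) (subst (s ≲_) (regroup x y) h))
  }
  where
  resize : List ℕ → List ℕ → List ℕ
  resize x y = u ++ pick x b ++ w ++ pick y c ++ v
  in₁ : x ≲ z₁ → x ≲ b
  in₁ p = ≲-trans p (≅⇒≲ (≅-sym e))
  in₂ : x ≲ z₂ → x ≲ c
  in₂ p = ≲-trans p (≅⇒≲ (≅-sym f))
  regroup : ∀ x y → resize x y ≡ (u ++ pick x b ++ w) ++ pick y c ++ v
  regroup x y = sym (trans (Listₚ.++-assoc u _ _) (cong (u ++_) (Listₚ.++-assoc (pick x b) w (pick y c ++ v))))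
  sizes : ∀ {x y xs ys} → xs ≅ x → ys ≅ y →
          length (u ++ xs ++ w ++ ys ++ v) ≡ length u + (length w + length v) + (length x + length y)
  sizes {x} {y} {xs} {ys} e f rewrite sym (≅-length e) | sym (≅-length f) = begin
    length (u ++ xs ++ w ++ ys ++ v) ≡⟨ Listₚ.length-++ u ⟩
    length u + length (xs ++ w ++ ys ++ v) ≡⟨ cong (length u +_) (Listₚ.length-++ xs) ⟩
    length u + (length xs + length (w ++ ys ++ v))
      ≡⟨ cong (λ n → length u + (length xs + n)) (trans (Listₚ.length-++ w) (cong (length w +_) (Listₚ.length-++ ys))) ⟩
    length u + (length xs + (length w + (length ys + length v)))
      ≡⟨ solve 5 (λ a b c d e → a :+ (b :+ (c :+ (d :+ e))) := a :+ (c :+ e) :+ (b :+ d)) refl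
            (length u) (length xs) (length w) (length ys) (length v) ⟩
    length u + (length w + length v) + (length xs + length ys) ∎
    where
    open ≡-Reasoning
    open +-*-Solver

ordered-slots : NoOverlap z₁ z₂ → (h₁ : Has z₁ s) (h₂ : Has z₂ s) → length (Has.before h₁) ≤ length (Has.before h₂) →
                Slots z₁ z₂ s
ordered-slots apart h₁@(has {u} {b} {v} refl e I) h₂@(has {u′} {c} {v′} whole f J) h
  with split-after (u ++ b) u′ (trans (Listₚ.++-assoc u b v) whole) (ordered apart h₁ h₂ h)
... | w , refl , refl = blocks I (subst (λ l → Interval l c v′) (Listₚ.++-assoc u b w) J) e f

slots : Apart z₁ z₂ → Has z₁ s → Has z₂ s → Slots z₁ z₂ s
slots (apart , apart′) h₁ h₂ with ℕₚ.≤-total (length (Has.before h₁)) (length (Has.before h₂))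
... | inj₁ h = ordered-slots apart h₁ h₂ h
... | inj₂ h = flip (ordered-slots apart′ h₂ h₁ h)

Annihilates : List ℕ → Set
Annihilates z = ∀ {s} → Has z s → M s ≡ 0ℤ

PairBelow : List ℕ → List ℕ → List ℕ → Set
PairBelow π x y = ∀ {s} → length s < length π → Has x s → Has y s → M s ≡ 0ℤ

AnnihilatorPair : List ℕ → List ℕ → Set
AnnihilatorPair x y = ∀ {s} → Has x s → Has y s → M s ≡ 0ℤ

by-length : (P : List ℕ → Set) → (∀ {π} → (∀ {s} → length s < length π → P s) → P π) → ∀ {π} → P π
by-length P step {π} = go (suc (length π)) ℕₚ.≤-refl
  where
  go : ∀ n {s} → length s < n → P s
  go (suc n) (s≤s h) = step (λ h′ → go n (ℕₚ.<-≤-trans h′ h))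

-- Strong induction on length is used because a shorter pattern of `π` may again have intervals of
-- both shapes.
pair-by-slots : Apart z₁ z₂ → (∀ {π} → PairBelow π z₁ z₂ → Slots z₁ z₂ π → M π ≡ 0ℤ) → AnnihilatorPair z₁ z₂
pair-by-slots {z₁} {z₂} apart step {π} = by-length (λ s → Has z₁ s → Has z₂ s → M s ≡ 0ℤ)
  (λ ih h₁ h₂ → step ih (slots apart h₁ h₂)) {π}

module _ (S : Slots z₁ z₂ π) where
  open Slots S

  resize-mono : x ≲ x′ → x′ ≲ z₁ → y ≲ y′ → y′ ≲ z₂ → s ≲ resize x y → s ≲ resize x′ y′
  resize-mono p p′ q q′ h with shrinkˡ (≲-trans p p′) p′ (≲⇒shrinks p) h
  ... | inj₁ h′ with shrinkʳ (≲-trans q q′) q′ (≲⇒shrinks q) h′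
  ...   | inj₁ h″ = h″

  resize-≲ : x ≲ z₁ → y ≲ z₂ → resize x y ≲ π
  resize-≲ p q = subst (_ ≲_) full (resize-mono p (≅⇒≲ ≅-refl) q (≅⇒≲ ≅-refl) (≅⇒≲ ≅-refl))

  resize-long : x ≲ z₁ → y ≲ z₂ → 1 ≤ length x → 1 ≤ length y → 2 ≤ length (resize x y)
  resize-long p q h h′ = subst (2 ≤_) (sym (size p q)) (ℕₚ.≤-trans (ℕₚ.+-mono-≤ h h′) (ℕₚ.m≤n+m _ rest))

  resize-shorter : x ≲ z₁ → y ≲ z₂ → length x + length y < length z₁ + length z₂ → length (resize x y) < length π
  resize-shorter p q h =
    subst₂ _<_ (sym (size p q)) (trans (sym (size (≅⇒≲ ≅-refl) (≅⇒≲ ≅-refl))) (cong length full)) (ℕₚ.+-monoʳ-< rest h)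

  -- The indicator of the patterns of π contained neither in resize k₁ z₂ nor in resize z₁ k₂,
  -- provided that those contained in both are contained in resize k₁ k₂.
  tip : List ℕ → List ℕ → List ℕ → ℤ
  tip k₁ k₂ τ = (ι τ (resize z₁ z₂) -ᶻ ι τ (resize k₁ z₂)) -ᶻ (ι τ (resize z₁ k₂) -ᶻ ι τ (resize k₁ k₂))

  evaluate : ∀ {τ a b c d} → ι τ (resize z₁ z₂) ≡ a → ι τ (resize k₁ z₂) ≡ b →
             ι τ (resize z₁ k₂) ≡ c → ι τ (resize k₁ k₂) ≡ d →
             tip k₁ k₂ τ ≡ (a -ᶻ b) -ᶻ (c -ᶻ d)
  evaluate p q r s = cong₂ _-ᶻ_ (cong₂ _-ᶻ_ p q) (cong₂ _-ᶻ_ r s)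

  module _ (k₁≲ : k₁ ≲ z₁) (k₂≲ : k₂ ≲ z₂) where

    private
      z₁≲ : z₁ ≲ z₁
      z₁≲ = ≅⇒≲ ≅-refl
      z₂≲ : z₂ ≲ z₂
      z₂≲ = ≅⇒≲ ≅-refl

    -- One entry in each block gives all four resized lists the length of at least 2 that
    -- `balanced-ι` demands.
    tip-balanced : 1 ≤ length k₁ → 1 ≤ length k₂ → Balanced π (tip k₁ k₂)
    tip-balanced h h′ = balanced-- (balanced-- (term z₁≲ z₂≲ g g′) (term k₁≲ z₂≲ h g′))
                                   (balanced-- (term z₁≲ k₂≲ g h′) (term k₁≲ k₂≲ h h′))
      where
      g  = ℕₚ.≤-trans h (≲-length k₁≲)
      g′ = ℕₚ.≤-trans h′ (≲-length k₂≲)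
      term : x ≲ z₁ → y ≲ z₂ → 1 ≤ length x → 1 ≤ length y → Balanced π (λ τ → ι τ (resize x y))
      term p q h h′ = balanced-ι (resize-≲ p q) (resize-long p q h h′)

    tip-top : length k₁ < length z₁ → length k₂ < length z₂ → tip k₁ k₂ (st π) ≡ 1ℤ
    tip-top h h′ = evaluate
      (ι-in π (resize z₁ z₂) (subst (π ≲_) (sym full) (≅⇒≲ ≅-refl)))
      (ι-longer π (resize k₁ z₂) (resize-shorter k₁≲ z₂≲ (ℕₚ.+-monoˡ-< _ h)))
      (ι-longer π (resize z₁ k₂) (resize-shorter z₁≲ k₂≲ (ℕₚ.+-monoʳ-< (length z₁) h′)))
      (ι-longer π (resize k₁ k₂) (resize-shorter k₁≲ k₂≲ (ℕₚ.+-mono-< h h′)))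

    -- If `s` lies in exactly one of `resize k₁ z₂` and `resize z₁ k₂`, two terms cancel; if it lies
    -- in `resize k₁ k₂`, all four do. In each remaining case shrinking fails on both sides, so both
    -- kinds of exception occur.
    tip-zero : Shrinks E₁ z₁ k₁ → Shrinks E₂ z₂ k₂ → s ≲ π → tip k₁ k₂ (st s) ≡ 0ℤ ⊎ (Exception E₁ s × Exception E₂ s)
    tip-zero {s = s} S₁ S₂ s≲π = cases (s ≲? resize k₁ z₂) (s ≲? resize z₁ k₂)
      where
      p : s ≲ resize z₁ z₂
      p = subst (s ≲_) (sym full) s≲π
      1₁ = ι-in s (resize z₁ z₂) p
      cases : Dec (s ≲ resize k₁ z₂) → Dec (s ≲ resize z₁ k₂) → _
      cases (no ¬q) (no ¬r) with shrinkˡ z₁≲ k₁≲ S₁ p | shrinkʳ z₂≲ k₂≲ S₂ p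
      ... | inj₁ q | _      = ⊥-elim (¬q q)
      ... | _      | inj₁ r = ⊥-elim (¬r r)
      ... | inj₂ e | inj₂ f = inj₂ (e , f)
      cases (yes q) (no ¬r) = inj₁ (evaluate 1₁ (ι-in s (resize k₁ z₂) q) (ι-out s (resize z₁ k₂) ¬r)
        (ι-out s (resize k₁ k₂) (¬r ∘ resize-mono k₁≲ z₁≲ (≅⇒≲ ≅-refl) k₂≲)))
      cases (no ¬q) (yes r) = inj₁ (evaluate 1₁ (ι-out s (resize k₁ z₂) ¬q) (ι-in s (resize z₁ k₂) r)
        (ι-out s (resize k₁ k₂) (¬q ∘ resize-mono (≅⇒≲ ≅-refl) k₁≲ k₂≲ z₂≲)))
      cases (yes q) (yes r) with shrinkʳ z₂≲ k₂≲ S₂ q | shrinkˡ z₁≲ k₁≲ S₁ r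
      ... | inj₁ m | _      = inj₁ (evaluate 1₁ (ι-in s (resize k₁ z₂) q) (ι-in s (resize z₁ k₂) r) (ι-in s (resize k₁ k₂) m))
      ... | _      | inj₁ m = inj₁ (evaluate 1₁ (ι-in s (resize k₁ z₂) q) (ι-in s (resize z₁ k₂) r) (ι-in s (resize k₁ k₂) m))
      ... | inj₂ f | inj₂ e = inj₂ (e , f)


-- The conditions on replacing `z` by `k`: `nonempty` keeps the resized lists long enough to be
-- balanced, and `shorter` makes the coefficient at `π` equal to 1.
record Core (E : List (List ℕ)) (z k : List ℕ) : Set where
  constructor core
  field
    contained : k ≲ z
    nonempty  : 1 ≤ length k
    shorter   : length k < length z
    shrinking : Shrinks E z k
open Core

core? : ∀ E z k → Dec (k ≲ z × 1 ≤ length k × length k < length z × ShrinkTable E z k)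
core? E z k = (k ≲? z) ×-dec (1 ≤? length k) ×-dec (length k <? length z) ×-dec shrinks? E z k

core! : True (core? E z k) → Core E z k
core! {E} {z} {k} t with toWitness {a? = core? E z k} t
... | p , q , r , h = core p q r (shrinks h)

excepted : {P : List ℕ → Set} → (∀ {z} → Has z s → P z → M s ≡ 0ℤ) → Exception E s → All P E → M s ≡ 0ℤ
excepted f (here h)  (p ∷ _)  = f h p
excepted f (there e) (_ ∷ ps) = excepted f e ps

split-exception : ∀ E {D} → Exception (E ++ D) s → Exception E s ⊎ Exception D s
split-exception E = Anyₚ.++⁻ E

-- The version with a single block: the combination is the indicator of the patterns of `π` minus
-- that of the patterns of `r`, where `k` replaces the block. Patterns of `π` outside `r` again have
-- an interval `z` and are settled by induction.
annihilator : 2 ≤ length k → Core (z ∷ []) z k → Annihilates z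
annihilator {k} {z} 2≤k C {π} = by-length (λ s → Has z s → M s ≡ 0ℤ) step {π}
  where
  step : ∀ {π} → (∀ {s} → length s < length π → Has z s → M s ≡ 0ℤ) → Has z π → M π ≡ 0ℤ
  step {π} ih (has {u} {b} {v} refl e I) = vanishing 2≤π
    (balanced-- (balanced-ι (≅⇒≲ ≅-refl) 2≤π) (balanced-ι r≲π 2≤r))
    (cong₂ _-ᶻ_ (ι-in π π (≅⇒≲ ≅-refl)) (ι-longer π r r<π))
    λ {s} s⊆ s< → cases s s⊆ s< (s ≲? r)
    where
    k≲b : k ≲ b
    k≲b = ≲-trans (contained C) (≅⇒≲ (≅-sym e))
    r = u ++ pick k b ++ v
    r≲π : r ≲ π
    r≲π = ⊆⇒≲ (Subₚ.++⁺ {as = u} ⊆-refl (Subₚ.++⁺ (pick-⊆ k b) ⊆-refl))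
    r<π : length r < length π
    r<π = subst₂ _<_ (sym (size (pick k b))) (sym (size b)) (ℕₚ.+-monoʳ-< (length u) (ℕₚ.+-monoˡ-< (length v)
            (subst₂ _<_ (sym (≅-length (pick-≅ k≲b))) (sym (≅-length e)) (shorter C))))
      where
      size : ∀ c → length (u ++ c ++ v) ≡ length u + (length c + length v)
      size c = trans (Listₚ.length-++ u) (cong (length u +_) (Listₚ.length-++ c))
    2≤r : 2 ≤ length r
    2≤r = ℕₚ.≤-trans (subst (2 ≤_) (sym (≅-length (pick-≅ k≲b))) 2≤k)
            (Subₚ.length-mono-≤ (Subₚ.++⁺ˡ u (Subₚ.++⁺ʳ v (⊆-refl {x = pick k b}))))
    2≤π = ℕₚ.≤-trans 2≤r (ℕₚ.<⇒≤ r<π)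
    cases : ∀ s → s ⊆ π → length s < length π → Dec (s ≲ r) → M s ≡ 0ℤ ⊎ ι (st s) π -ᶻ ι (st s) r ≡ 0ℤ
    cases s s⊆ s< (yes p) = inj₂ (cong₂ _-ᶻ_ (ι-in s π (⊆⇒≲ s⊆)) (ι-in s r p))
    cases s s⊆ s< (no ¬p) with shrink I ⊆-refl (pick-⊆ k b) (Shrinks-resp-≅ e (pick-≅ k≲b) (shrinking C)) (⊆⇒≲ s⊆)
    ... | inj₁ p        = ⊥-elim (¬p p)
    ... | inj₂ (here h) = inj₁ (ih s< h)

-- An exception from `D` on either side suffices alone; otherwise the two exceptions form a pair
-- from `E₁` and `E₂`.
pair-exceptions : ∀ {D π} → All Annihilates D → All (λ x → All (PairBelow π x) E₂) E₁ → length s < length π →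
                  Exception (E₁ ++ D) s → Exception (E₂ ++ D) s → M s ≡ 0ℤ
pair-exceptions {E₂ = E₂} {E₁ = E₁} dead table s< e f with split-exception E₁ e | split-exception E₂ f
... | inj₂ d | _      = excepted (λ h a → a h) d dead
... | _      | inj₂ d = excepted (λ h a → a h) d dead
... | inj₁ e | inj₁ f = excepted (λ h → excepted (λ h′ p → p s< h h′) f) e table

slots-long : (S : Slots z₁ z₂ π) → 1 ≤ length z₁ → 1 ≤ length z₂ → 2 ≤ length π
slots-long S h h′ = subst (λ l → 2 ≤ length l) (Slots.full S) (resize-long S (≅⇒≲ ≅-refl) (≅⇒≲ ≅-refl) h h′)

-- The general step from known pairs to a new one. `table` receives the induction hypothesis because
-- `z₁` and `z₂` may themselves be among the exceptions.
diamond : ∀ {D} → Apart z₁ z₂ → All Annihilates D → Core (E₁ ++ D) z₁ k₁ → Core (E₂ ++ D) z₂ k₂ →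
          (∀ {π} → PairBelow π z₁ z₂ → All (λ x → All (PairBelow π x) E₂) E₁) → AnnihilatorPair z₁ z₂
diamond {k₁ = k₁} {k₂ = k₂} apart dead C₁ C₂ table = pair-by-slots apart λ {π} ih S → vanishing
  (slots-long S (ℕₚ.≤-trans (nonempty C₁) (ℕₚ.<⇒≤ (shorter C₁))) (ℕₚ.≤-trans (nonempty C₂) (ℕₚ.<⇒≤ (shorter C₂))))
  (tip-balanced S (contained C₁) (contained C₂) (nonempty C₁) (nonempty C₂))
  (tip-top S (contained C₁) (contained C₂) (shorter C₁) (shorter C₂))
  λ s⊆ s< → Sum.swap (Sum.map₂ (λ (e , f) → pair-exceptions {π = π} dead (table {π} ih) s< e f)
    (tip-zero S (contained C₁) (contained C₂) (shrinking C₁) (shrinking C₂) (⊆⇒≲ s⊆)))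

-- The particular annihilators and annihilator pairs

p1 p12 p21 p123 p132 p231 p312 p1243 p1423 p2134 p2413 : List ℕ
p1 = 0 ∷ []
p12 = 0 ∷ 1 ∷ []
p21 = 1 ∷ 0 ∷ []
p123 = 0 ∷ 1 ∷ 2 ∷ []
p132 = 0 ∷ 2 ∷ 1 ∷ []
p231 = 1 ∷ 2 ∷ 0 ∷ []
p312 = 2 ∷ 0 ∷ 1 ∷ []
p1243 = 0 ∷ 1 ∷ 3 ∷ 2 ∷ []
p1423 = 0 ∷ 3 ∷ 1 ∷ 2 ∷ []
p2134 = 1 ∷ 0 ∷ 2 ∷ 3 ∷ []
p2413 = 1 ∷ 3 ∷ 0 ∷ 2 ∷ []

occurs! : True (occurs? z b) → Has b s → Has z s
occurs! {z} {b} t h = Has-trans (occurs⇒has (toWitness {a? = occurs? z b} t)) h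

apart! : True (apart? z₁ z₂) → Apart z₁ z₂
apart! {z₁} {z₂} = toWitness {a? = apart? z₁ z₂}

-- Each of 12 and 21 is its own only pattern not contained in 1, so the induction hypothesis is the
-- whole table.
pair-12-21 : AnnihilatorPair p12 p21
pair-12-21 = diamond {E₁ = p12 ∷ []} {k₁ = p1} {E₂ = p21 ∷ []} {k₂ = p1} (apart! tt) [] (core! tt) (core! tt)
  λ ih → (ih ∷ []) ∷ []

opposing : ∀ x y {_ : True (occurs? p12 x)} {_ : True (occurs? p21 y)} → AnnihilatorPair x y
opposing x y {t} {t′} h h′ = pair-12-21 (occurs! {p12} {x} t h) (occurs! {p21} {y} t′ h′)

annihilators : List (List ℕ)
annihilators = p123 ∷ p1243 ∷ p2134 ∷ []

-- 123 is shrunk to 12, while 1243 and 2134 each contain both an interval 12 and an interval 21.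
annihilates : All Annihilates annihilators
annihilates =
  annihilator {k = p12} (s≤s (s≤s z≤n)) (core! tt) ∷ (λ h → opposing p1243 p1243 h h) ∷ (λ h → opposing p2134 p2134 h h) ∷ []

contained! : True (x ≲? y) → x ≲ y
contained! {x} {y} = toWitness {a? = x ≲? y}

shrinks! : True (shrinks? E x y) → Shrinks E x y
shrinks! {E} {x} {y} t = shrinks (toWitness {a? = shrinks? E x y} t)

record Reduces (E : List (List ℕ)) (z x k : List ℕ) : Set where
  constructor reduces
  field
    contained : k ≲ x
    within    : x ≲ z
    shrinking : Shrinks E x k

reduces! : True ((k ≲? x) ×-dec (x ≲? z) ×-dec shrinks? E x k) → Reduces E z x k
reduces! {k} {x} {z} {E} t with toWitness {a? = (k ≲? x) ×-dec (x ≲? z) ×-dec shrinks? E x k} t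
... | p , q , r = reduces p q (shrinks r)

-- This serves to rewrite the terms of one combination as those of another at patterns without
-- exceptional intervals.
ι-resize : (S : Slots z₁ z₂ π) → Reduces E z₁ x x′ → Reduces E z₂ y y′ → ∀ s →
           ι (st s) (Slots.resize S x y) ≡ ι (st s) (Slots.resize S x′ y′) ⊎ Exception E s
ι-resize {x = x} {x′} {y} {y′} S (reduces p p′ P) (reduces q q′ Q) s = cases (s ≲? resize x y)
  where
  open Slots S
  cases : Dec (s ≲ resize x y) → _
  cases (no ¬h) = inj₁ (trans (ι-out s (resize x y) ¬h) (sym (ι-out s (resize x′ y′) (¬h ∘ resize-mono S p p′ q q′))))
  cases (yes h) with shrinkˡ p′ (≲-trans p p′) P h
  ... | inj₂ e = inj₂ e
  ... | inj₁ h′ with shrinkʳ q′ (≲-trans q q′) Q h′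
  ...   | inj₂ e  = inj₂ e
  ...   | inj₁ h″ = inj₁ (trans (ι-in s (resize x y) h) (sym (ι-in s (resize x′ y′) h″)))

module _ (S : Slots p1423 p231 π) where
  open Slots S

  -- The patterns of π that violate tip p312 p12 ≡ 0 because they have a descent interval
  -- are those in resize p132 p21 but not in resize p21 p21 nor in resize p132 p1.
  descents : List ℕ → ℤ
  descents τ = (ι τ (resize p132 p21) -ᶻ ι τ (resize p21 p21)) -ᶻ (ι τ (resize p132 p1) -ᶻ ι τ (resize p21 p1))

  descents-balanced : Balanced π descents
  descents-balanced = balanced-- (balanced-- (term p132 p21) (term p21 p21)) (balanced-- (term p132 p1) (term p21 p1))
    where
    term : ∀ x y {_ : True ((x ≲? p1423) ×-dec (y ≲? p231) ×-dec (1 ≤? length x) ×-dec (1 ≤? length y))} →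
           Balanced π (λ τ → ι τ (resize x y))
    term x y {t} with toWitness {a? = (x ≲? p1423) ×-dec (y ≲? p231) ×-dec (1 ≤? length x) ×-dec (1 ≤? length y)} t
    ... | p , q , h , h′ = balanced-ι (resize-≲ S p q) (resize-long S p q h h′)

  descents-top : descents (st π) ≡ 0ℤ
  descents-top = cong₂ _-ᶻ_ (cong₂ _-ᶻ_ (term p132 p21) (term p21 p21)) (cong₂ _-ᶻ_ (term p132 p1) (term p21 p1))
    where
    -- 7 is the sum of the lengths of 1423 and 231.
    term : ∀ x y {_ : True ((x ≲? p1423) ×-dec (y ≲? p231) ×-dec (length x + length y <? 7))} → ι (st π) (resize x y) ≡ 0ℤ
    term x y {t} with toWitness {a? = (x ≲? p1423) ×-dec (y ≲? p231) ×-dec (length x + length y <? 7)} t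
    ... | p , q , h = ι-longer π (resize x y) (resize-shorter S p q h)

  -- Without interval 21 the second block 21 may be shrunk to 1, so the two halves of `descents`
  -- cancel and only `tip` remains. Its other exceptions are annihilators or the pair itself.
  no-descent : s ≲ π → PairBelow π p1423 p231 → length s < length π →
               tip S p312 p12 (st s) -ᶻ descents (st s) ≡ 0ℤ ⊎ M s ≡ 0ℤ ⊎ Has p21 s
  no-descent {s} s≲π ih s< = combine
    (ι-resize S (reduces! {p132} {p132} tt) (reduces! {p1} {p21} {E = p21 ∷ []} tt) s)
    (ι-resize S (reduces! {p21} {p21} tt) (reduces! {p1} {p21} {E = p21 ∷ []} tt) s)
    (tip-zero S {p312} {p12} (contained! tt) (contained! tt)
      (shrinks! {E = (p1423 ∷ p21 ∷ []) ++ annihilators} tt) (shrinks! {E = (p231 ∷ p21 ∷ []) ++ annihilators} tt) s≲π)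
    where
    combine : ι (st s) (resize p132 p21) ≡ ι (st s) (resize p132 p1) ⊎ Exception (p21 ∷ []) s →
              ι (st s) (resize p21 p21) ≡ ι (st s) (resize p21 p1) ⊎ Exception (p21 ∷ []) s →
              tip S p312 p12 (st s) ≡ 0ℤ ⊎
                (Exception ((p1423 ∷ p21 ∷ []) ++ annihilators) s × Exception ((p231 ∷ p21 ∷ []) ++ annihilators) s) →
              tip S p312 p12 (st s) -ᶻ descents (st s) ≡ 0ℤ ⊎ M s ≡ 0ℤ ⊎ Has p21 s
    combine (inj₂ (here h)) _ _ = inj₂ (inj₂ h)
    combine _ (inj₂ (here h)) _ = inj₂ (inj₂ h)
    combine _ _ (inj₂ (here h , here h′)) = inj₂ (inj₁ (ih s< h h′))
    combine _ _ (inj₂ (there (here h) , _)) = inj₂ (inj₂ h)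
    combine _ _ (inj₂ (_ , there (here h))) = inj₂ (inj₂ h)
    combine _ _ (inj₂ (there (there d) , _)) = inj₂ (inj₁ (excepted (λ h a → a h) d annihilates))
    combine _ _ (inj₂ (_ , there (there d))) = inj₂ (inj₁ (excepted (λ h a → a h) d annihilates))
    combine (inj₁ e) (inj₁ f) (inj₁ g) = inj₁ (cong₂ _-ᶻ_ g (trans
      (cong (_-ᶻ (ι (st s) (resize p132 p1) -ᶻ ι (st s) (resize p21 p1))) (cong₂ _-ᶻ_ e f))
      (ℤₚ.+-inverseʳ (ι (st s) (resize p132 p1) -ᶻ ι (st s) (resize p21 p1)))))

  -- Without interval 12, the blocks 1423, 312, 231 and 12 may be shrunk to 132, 21, 21 and 1, which
  -- turns the four terms of `tip` into those of `descents`.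
  no-ascent : ∀ s → tip S p312 p12 (st s) ≡ descents (st s) ⊎ Has p12 s
  no-ascent s = combine
    (ι-resize S (reduces! {p132} {p1423} {E = p12 ∷ []} tt) (reduces! {p21} {p231} tt) s)
    (ι-resize S (reduces! {p21} {p312} {E = p12 ∷ []} tt) (reduces! {p21} {p231} tt) s)
    (ι-resize S (reduces! {p132} {p1423} {E = p12 ∷ []} tt) (reduces! {p1} {p12} tt) s)
    (ι-resize S (reduces! {p21} {p312} {E = p12 ∷ []} tt) (reduces! {p1} {p12} tt) s)
    where
    combine : ∀ {a b c d} → ι (st s) (resize p1423 p231) ≡ a ⊎ Exception (p12 ∷ []) s →
              ι (st s) (resize p312 p231) ≡ b ⊎ Exception (p12 ∷ []) s →
              ι (st s) (resize p1423 p12) ≡ c ⊎ Exception (p12 ∷ []) s →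
              ι (st s) (resize p312 p12) ≡ d ⊎ Exception (p12 ∷ []) s →
              tip S p312 p12 (st s) ≡ (a -ᶻ b) -ᶻ (c -ᶻ d) ⊎ Has p12 s
    combine (inj₂ (here h)) _ _ _ = inj₂ h
    combine _ (inj₂ (here h)) _ _ = inj₂ h
    combine _ _ (inj₂ (here h)) _ = inj₂ h
    combine _ _ _ (inj₂ (here h)) = inj₂ h
    combine (inj₁ a) (inj₁ b) (inj₁ c) (inj₁ d) = inj₁ (evaluate S {p312} {p12} {st s} a b c d)

-- The combination is `tip` minus `descents`. Where its coefficient is not shown to vanish, either
-- `M s` is already known to be zero or `s` has both intervals 12 and 21.
pair-1423-231 : AnnihilatorPair p1423 p231
pair-1423-231 = pair-by-slots (apart! tt) λ {π} ih S → vanishing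
  (slots-long S (s≤s z≤n) (s≤s z≤n))
  (balanced-- (tip-balanced S (contained! tt) (contained! tt) (s≤s z≤n) (s≤s z≤n)) (descents-balanced S))
  (cong₂ _-ᶻ_ (tip-top S (contained! tt) (contained! tt) ℕₚ.≤-refl ℕₚ.≤-refl) (descents-top S))
  λ {s} s⊆ s< → cases S s s< (no-descent S (⊆⇒≲ s⊆) ih s<)
  where
  cases : (S : Slots p1423 p231 π) → ∀ s → length s < length π →
          tip S p312 p12 (st s) -ᶻ descents S (st s) ≡ 0ℤ ⊎ M s ≡ 0ℤ ⊎ Has p21 s →
          M s ≡ 0ℤ ⊎ tip S p312 p12 (st s) -ᶻ descents S (st s) ≡ 0ℤ
  cases S s _ (inj₁ e)        = inj₂ e
  cases S s _ (inj₂ (inj₁ e)) = inj₁ e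
  cases S s _ (inj₂ (inj₂ h)) with no-ascent S s
  ... | inj₁ e  = inj₂ (ℤₚ.i≡j⇒i-j≡0 e)
  ... | inj₂ h′ = inj₁ (pair-12-21 h′ h)

-- The patterns of 1423 outside 312 are 1423, 132 and 123. Those of 23514 outside 2413 are 23514,
-- 2314 with interval 231, and 1243, 2341, 123 with annihilating intervals.
pair-1423-23514 : AnnihilatorPair p1423 p23514
pair-1423-23514 = diamond {E₁ = p1423 ∷ p21 ∷ []} {k₁ = p312} {E₂ = p23514 ∷ p231 ∷ []} {k₂ = p2413}
  (apart! tt) annihilates (core! tt) (core! tt) λ ih →
  (ih ∷ (λ _ → pair-1423-231) ∷ []) ∷
  ((λ _ h h′ → opposing p23514 p21 h′ h) ∷ (λ _ h h′ → opposing p231 p21 h′ h) ∷ []) ∷ []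

-- The patterns of 25134 outside 2413 are 25134, 1423, and 4123, 2134, 123 with annihilating
-- intervals. Against 21 the interval 12 of 25134 or 1423 is used.
pair-25134-231 : AnnihilatorPair p25134 p231
pair-25134-231 = diamond {E₁ = p25134 ∷ p1423 ∷ []} {k₁ = p2413} {E₂ = p231 ∷ p21 ∷ []} {k₂ = p12}
  (apart! tt) annihilates (core! tt) (core! tt) λ ih →
  (ih ∷ (λ _ → opposing p25134 p21) ∷ []) ∷
  ((λ _ → pair-1423-231) ∷ (λ _ → opposing p1423 p21) ∷ []) ∷ []

-- Of the four pairs of exceptions one is settled by induction, and the others are the three
-- preceding pairs.
pair-25134-23514 : AnnihilatorPair p25134 p23514
pair-25134-23514 = diamond {E₁ = p25134 ∷ p1423 ∷ []} {k₁ = p2413} {E₂ = p23514 ∷ p231 ∷ []} {k₂ = p2413}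
  (apart! tt) annihilates (core! tt) (core! tt) λ ih →
  (ih ∷ (λ _ → pair-25134-231) ∷ []) ∷
  ((λ _ → pair-1423-23514) ∷ (λ _ → pair-1423-231) ∷ []) ∷ []

-- Inflations

countLess-++ : ∀ x xs {ys} → countLess x (xs ++ ys) ≡ countLess x xs + countLess x ys
countLess-++ x []       = refl
countLess-++ x (y ∷ xs) = trans (cong (_ +_) (countLess-++ x xs)) (sym (ℕₚ.+-assoc (if y <ᵇ x then 1 else 0) _ _))

countLess-all : ∀ x xs → All (_< x) xs → countLess x xs ≡ length xs
countLess-all x []       []       = refl
countLess-all x (y ∷ xs) (h ∷ hs) rewrite <ᵇ-true h = cong suc (countLess-all x xs hs)

countLess-none : ∀ x xs → All (x ≤_) xs → countLess x xs ≡ 0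
countLess-none x []       []       = refl
countLess-none x (y ∷ xs) (h ∷ hs) rewrite <ᵇ-false h = countLess-none x xs hs

+-<ᵇ : ∀ n x y → (n + x <ᵇ n + y) ≡ (x <ᵇ y)
+-<ᵇ zero    x y = refl
+-<ᵇ (suc n) x y = +-<ᵇ n x y

countLess-shift : ∀ n x xs → countLess (n + x) (map (n +_) xs) ≡ countLess x xs
countLess-shift n x []       = refl
countLess-shift n x (y ∷ xs) = cong₂ _+_ (cong (if_then 1 else 0) (+-<ᵇ n y x)) (countLess-shift n x xs)

shift-≅ : ∀ n xs → map (n +_) xs ≅ xs
shift-≅ n xs = st≡⇒≅ (trans (sym (Listₚ.map-∘ xs)) (Listₚ.map-cong (λ x → countLess-shift n x xs) xs))

Blocks : Set
Blocks = List (ℕ × List ℕ)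

offset-mono : ∀ {t t′} (rest : Blocks) → t ≤ t′ → offset t rest ≤ offset t′ rest
offset-mono [] h = z≤n
offset-mono {t} {t′} ((r , b) ∷ rest) h with r <ᵇ t | ℕₚ.<ᵇ⇒< r t
... | false | _ = ℕₚ.+-mono-≤ z≤n (offset-mono rest h)
... | true  | f rewrite <ᵇ-true (ℕₚ.<-≤-trans (f tt) h) = ℕₚ.+-monoʳ-≤ (length b) (offset-mono rest h)

offset-step : ∀ {t t′ b} (rest : Blocks) → t < t′ → (t , b) ∈ rest → offset t rest + length b ≤ offset t′ rest
offset-step {t} {t′} {b} (_ ∷ rest) h (here refl) rewrite n≮ᵇn t | <ᵇ-true h =
  subst (_≤ length b + offset t′ rest) (ℕₚ.+-comm (length b) (offset t rest)) (ℕₚ.+-monoʳ-≤ (length b) (offset-mono rest (ℕₚ.<⇒≤ h)))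
offset-step {t} {t′} {b} ((r , c) ∷ rest) h (there p) with r <ᵇ t | ℕₚ.<ᵇ⇒< r t
... | false | _ = ℕₚ.≤-trans (offset-step rest h p) (ℕₚ.m≤n+m _ _)
... | true  | f rewrite <ᵇ-true (ℕₚ.<-trans (f tt) h) =
  subst (_≤ length c + offset t′ rest) (sym (ℕₚ.+-assoc (length c) _ _)) (ℕₚ.+-monoʳ-≤ (length c) (offset-step rest h p))

-- Each entry is its own rank, so `b` is fixed by `st`; the bound keeps a shifted block within its
-- range of values.
Standard : List ℕ → Set
Standard b = All (λ v → countLess v b ≡ v × v < length b) b

module Inflation (tbs : Blocks) (unique : Unique (map proj₁ tbs)) (standard : All (Standard ∘ proj₂) tbs) where

  place : ℕ × List ℕ → List ℕ
  place (t , b) = map (offset t tbs +_) b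

  expand : Blocks → List ℕ
  expand = concatMap place

  -- `v` is below the length of its block, which `offset t′` counts in full on top of `offset t`.
  before-later : ∀ {t t′ b v} → t < t′ → (t , b) ∈ tbs → v ∈ b → ∀ v′ → offset t tbs + v < offset t′ tbs + v′
  before-later h p v∈ v′ = ℕₚ.<-≤-trans (ℕₚ.+-monoʳ-< _ (proj₂ (All.lookup (All.lookup standard p) v∈)))
    (ℕₚ.≤-trans (offset-step tbs h p) (ℕₚ.m≤m+n _ v′))

  -- A block of a smaller entry of the permutation counts with its full length and one of a larger
  -- entry not at all, as in the definition of `offset`.
  countLess-others : ∀ {t b v} → (t , b) ∈ tbs → v ∈ b → ∀ rest → (∀ {q} → q ∈ rest → q ∈ tbs) →
                     All (λ q → proj₁ q ≢ t) rest →
                     countLess (offset t tbs + v) (expand rest) ≡ offset t rest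
  countLess-others p v∈ [] sub [] = refl
  countLess-others {t} {b} {v} p v∈ ((r , c) ∷ rest) sub (r≢t ∷ others) =
    trans (countLess-++ _ (place (r , c))) (cong₂ _+_ head (countLess-others p v∈ rest (sub ∘ there) others))
    where
    head : countLess (offset t tbs + v) (place (r , c)) ≡ (if r <ᵇ t then length c else 0)
    head with ℕₚ.<-cmp r t
    ... | tri< h _ _ rewrite <ᵇ-true h = trans (countLess-all _ (place (r , c))
            (Allₚ.map⁺ (All.tabulate (λ v′∈ → before-later h (sub (here refl)) v′∈ v)))) (Listₚ.length-map _ c)
    ... | tri≈ _ e _ = ⊥-elim (r≢t e)
    ... | tri> _ _ h rewrite <ᵇ-false (ℕₚ.<⇒≤ h) = countLess-none _ (place (r , c))
            (Allₚ.map⁺ (All.tabulate (λ {v′} _ → ℕₚ.<⇒≤ (before-later h p v∈ v′))))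

  record Split (t : ℕ) (b : List ℕ) : Set where
    field
      {left right} : Blocks
      whole : tbs ≡ left ++ (t , b) ∷ right
      apart : All (λ q → proj₁ q ≢ t) (left ++ right)

  split : ∀ {t b} → (t , b) ∈ tbs → Split t b
  split {t} {b} p with ∈ₚ.∈-∃++ p
  ... | l , r , e = record { left = l ; right = r ; whole = e ; apart = go l (subst (Unique ∘ map proj₁) e unique) }
    where
    go : ∀ l → Unique (map proj₁ (l ++ (t , b) ∷ r)) → All (λ q → proj₁ q ≢ t) (l ++ r)
    go []      (h ∷ _) = All.map (λ ne e → ne (sym e)) (Allₚ.map⁻ h)
    go (q ∷ l) (h ∷ u) = All.lookup (Allₚ.map⁻ h) (∈ₚ.∈-insert l) ∷ go l u

  expand-split : ∀ {t b l r} → tbs ≡ l ++ (t , b) ∷ r → expand tbs ≡ expand l ++ place (t , b) ++ expand r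
  expand-split {t} {b} {l} {r} e = trans (cong expand e) (Listₚ.concatMap-++ place l ((t , b) ∷ r))

  offset-++ : ∀ t (l : Blocks) {r} → offset t (l ++ r) ≡ offset t l + offset t r
  offset-++ t []            = refl
  offset-++ t ((s , b) ∷ l) = trans (cong (_ +_) (offset-++ t l)) (sym (ℕₚ.+-assoc (if s <ᵇ t then length b else 0) _ _))

  countLess-expand : ∀ {t b v} → (t , b) ∈ tbs → v ∈ b → countLess (offset t tbs + v) (expand tbs) ≡ offset t tbs + v
  countLess-expand {t} {b} {v} p v∈ = begin
    countLess place₀ (expand tbs)                                                   ≡⟨ cong (countLess place₀) (expand-split whole) ⟩
    countLess place₀ (expand left ++ place (t , b) ++ expand right)
      ≡⟨ trans (countLess-++ place₀ (expand left)) (cong (countLess place₀ (expand left) +_) (countLess-++ place₀ (place (t , b)))) ⟩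
    countLess place₀ (expand left) + (countLess place₀ (place (t , b)) + countLess place₀ (expand right))
      ≡⟨ cong₂ _+_ (countLess-others p v∈ left (sub ∘ ∈ₚ.∈-++⁺ˡ) (Allₚ.++⁻ˡ left apart))
         (cong₂ _+_ (trans (countLess-shift (offset t tbs) v b) (proj₁ (All.lookup (All.lookup standard p) v∈)))
           (countLess-others p v∈ right (sub ∘ ∈ₚ.∈-++⁺ʳ left ∘ there) (Allₚ.++⁻ʳ left apart))) ⟩
    offset t left + (v + offset t right)                                       ≡⟨ cong (offset t left +_) (ℕₚ.+-comm v _) ⟩
    offset t left + (offset t right + v)                                       ≡⟨ sym (ℕₚ.+-assoc (offset t left) _ v) ⟩
    offset t left + offset t right + v
      -- `offset t` ignores the block of `t` itself, so that block can be inserted with contribution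
      -- 0.
      ≡⟨ cong (λ n → offset t left + (n + offset t right) + v) zero-length ⟩
    offset t left + offset t ((t , b) ∷ right) + v
      ≡⟨ cong (_+ v) (sym (trans (cong (offset t) whole) (offset-++ t left))) ⟩
    offset t tbs + v                                                           ∎
    where
    open ≡-Reasoning
    open Split (split p)
    place₀ = offset t tbs + v
    sub : ∀ {q} → q ∈ left ++ (t , b) ∷ right → q ∈ tbs
    sub = subst (_ ∈_) (sym whole)
    zero-length : 0 ≡ (if t <ᵇ t then length b else 0)
    zero-length rewrite n≮ᵇn t = refl

  ∈-expand : ∀ rest {x} → x ∈ expand rest → ∃₂ λ t b → (t , b) ∈ rest × ∃ λ v → v ∈ b × x ≡ offset t tbs + v
  ∈-expand ((t , b) ∷ rest) x∈ with ∈ₚ.∈-++⁻ (place (t , b)) x∈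
  ... | inj₁ p = t , b , here refl , ∈ₚ.∈-map⁻ (offset t tbs +_) p
  ... | inj₂ p = let t′ , b′ , q , r = ∈-expand rest p in t′ , b′ , there q , r

  -- This bridges `M`, which standardises its argument, and the theorem, which does not.
  expand-standard : st (expand tbs) ≡ expand tbs
  expand-standard = trans (Listₚ.map-cong-local (All.tabulate fixed)) (Listₚ.map-id _)
    where
    fixed : ∀ {x} → x ∈ expand tbs → countLess x (expand tbs) ≡ x
    fixed x∈ with ∈-expand tbs x∈
    ... | t , b , p , v , v∈ , refl = countLess-expand p v∈

  has-block : ∀ {t b} → (t , b) ∈ tbs → Has b (expand tbs)
  has-block {t} {b} p =
    has {before = expand left} {place (t , b)} {expand right} (expand-split whole)
      (shift-≅ (offset t tbs) b) (uniform same-side)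
    where
    open Split (split p)
    same-side : ∀ {e x y} → e ∈ expand left ++ expand right → x ∈ place (t , b) → y ∈ place (t , b) → SameSide e x y
    same-side e∈ x∈ y∈ with ∈-expand (left ++ right) (subst (_ ∈_) (sym (Listₚ.concatMap-++ place left right)) e∈)
                     | ∈ₚ.∈-map⁻ (offset t tbs +_) x∈ | ∈ₚ.∈-map⁻ (offset t tbs +_) y∈
    ... | r , c , q , w , w∈ , refl | v , v∈ , refl | v′ , v′∈ , refl with ℕₚ.<-cmp r t
    ...   | tri≈ _ e _ = ⊥-elim (All.lookup apart q e)
    ...   | tri< h _ _ = trans (<ᵇ-true (before-later h r∈ w∈ v)) (sym (<ᵇ-true (before-later h r∈ w∈ v′))) ,
                         trans (<ᵇ-false (ℕₚ.<⇒≤ (before-later h r∈ w∈ v))) (sym (<ᵇ-false (ℕₚ.<⇒≤ (before-later h r∈ w∈ v′))))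
            where r∈ = subst ((r , c) ∈_) (sym whole) ([ ∈ₚ.∈-++⁺ˡ , ∈ₚ.∈-++⁺ʳ left ∘ there ]′ (∈ₚ.∈-++⁻ left q))
    ...   | tri> _ _ h = trans (<ᵇ-false (ℕₚ.<⇒≤ (before-later h p v∈ w))) (sym (<ᵇ-false (ℕₚ.<⇒≤ (before-later h p v′∈ w)))) ,
                         trans (<ᵇ-true (before-later h p v∈ w)) (sym (<ᵇ-true (before-later h p v′∈ w)))

zip-proj₁ : {A B : Set} (as : List A) (bs : List B) → length as ≡ length bs → map proj₁ (zip as bs) ≡ as
zip-proj₁ []       []       _ = refl
zip-proj₁ (a ∷ as) (b ∷ bs) e = cong (a ∷_) (zip-proj₁ as bs (ℕₚ.suc-injective e))

∈-zip⁻ : {A B : Set} (as : List A) (bs : List B) {p : A × B} → p ∈ zip as bs → proj₂ p ∈ bs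
∈-zip⁻ (a ∷ as) (b ∷ bs) (here refl) = here refl
∈-zip⁻ (a ∷ as) (b ∷ bs) (there p)   = there (∈-zip⁻ as bs p)

-- `upTo` is `applyUpTo id`; the general `g` absorbs the shift of indices in the induction.
∈-zip-upTo : {A B : Set} (f : ℕ → B) (g : ℕ → ℕ) (as : List A) {i : ℕ} → i < length as →
             ∃ λ a → (a , f (g i)) ∈ zip as (map f (applyUpTo g (length as)))
∈-zip-upTo f g (a ∷ as) {zero}  _       = a , here refl
∈-zip-upTo f g (a ∷ as) {suc i} (s≤s h) = let a′ , p = ∈-zip-upTo f (g ∘ suc) as h in a′ , there p

blockAt-cases : ∀ {P : List ℕ → Set} i j {φ ψ} k → P φ → P ψ → P (0 ∷ []) → P (blockAt i j φ ψ k)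
blockAt-cases i j k p q r with k ≟ i | k ≟ j
... | yes _ | _     = p
... | no _  | yes _ = q
... | no _  | no _  = r

blockAt-i : ∀ i j φ ψ → blockAt i j φ ψ i ≡ φ
blockAt-i i j φ ψ with i ≟ i
... | yes _ = refl
... | no ne = ⊥-elim (ne refl)

blockAt-j : ∀ i j φ ψ → i ≢ j → blockAt i j φ ψ j ≡ ψ
blockAt-j i j φ ψ i≢j with j ≟ i | j ≟ j
... | yes e | _     = ⊥-elim (i≢j (sym e))
... | no _  | yes _ = refl
... | no _  | no ne = ⊥-elim (ne refl)

standard? : ∀ b → Dec (Standard b)
standard? b = All.all? (λ v → (countLess v b ≟ v) ×-dec (v <? length b)) b

theorem6p4 : (τ : Perm) → IsPerm τ → (i j : ℕ) → i < length τ → j < length τ → i ≢ j →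
    μ (0 ∷ []) (inflate2 τ i j p25134 p23514) ≡ 0ℤ
-- The inflation unfolds to `expand (zip τ pieces)`, which equals its own standardisation, so the
-- goal concerns `M`.
theorem6p4 τ perm i j i< j< i≢j = trans (cong (μ 𝟙) (sym expand-standard))
  (pair-25134-23514 (block (blockAt-i i j _ _) i<) (block (blockAt-j i j _ _ i≢j) j<))
  where
  pieces : List (List ℕ)
  pieces = map (blockAt i j p25134 p23514) (upTo (length τ))
  unique : Unique (map proj₁ (zip τ pieces))
  unique = subst Unique (sym (zip-proj₁ τ pieces
    (sym (trans (Listₚ.length-map _ (upTo (length τ))) (Listₚ.length-upTo (length τ))))))
    (Permₛ.Unique-resp-↭ (setoid ℕ) (↭⇒↭ₛ (↭-sym perm)) (Uniqueₚ.upTo⁺ (length τ)))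
  standard : All (Standard ∘ proj₂) (zip τ pieces)
  standard = All.tabulate λ p → standard-piece (∈ₚ.∈-map⁻ _ (∈-zip⁻ τ pieces p))
    where
    standard-piece : ∀ {b} → (∃ λ k → k ∈ upTo (length τ) × b ≡ blockAt i j p25134 p23514 k) → Standard b
    standard-piece (k , _ , refl) = blockAt-cases {Standard} i j k
      (toWitness {a? = standard? p25134} tt) (toWitness {a? = standard? p23514} tt) (toWitness {a? = standard? (0 ∷ [])} tt)
  open Inflation (zip τ pieces) unique standard
  block : ∀ {k b} → blockAt i j p25134 p23514 k ≡ b → k < length τ → Has b (expand (zip τ pieces))
  block refl h = has-block (proj₂ (∈-zip-upTo (blockAt i j p25134 p23514) id τ h))
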